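{- For $m,n\in \mathbb{Z}_{>1}$, \begin{align*} \zeta(m,n)=P(m,n), \end{align*} where \begin{align*} P(m,n):=&\sum^{m-1}_{i=0}(-1)^{i}\binom{n+i-1}{i}\zeta(n+i)\zeta_{\sqcup\!\sqcup}(m-i)\\ &\ +(-1)^{m}\sum^{n-1}_{j=0}\binom{m+j-1}{j}\Bigl\{\zeta(m+j)\zeta_{\sqcup\!\sqcup}(n-j)-\zeta^{\star}(n-j,m+j)\Bigr\}. \end{align*}
   Context: For $n\in\mathbb{Z}_{>0}$, $m\in\mathbb{Z}_{>1}$: $\zeta(m)=\sum_{k\ge1}k^{ -m}$, the double zeta value $\zeta(n,m)=\sum_{0<k_1<k_2}k_1^{ -n}k_2^{ -m}$, and the double zeta star value $\zeta^\star(n,m)=\sum_{0<k_1\le k_2}k_1^{ -n}k_2^{ -m}=\zeta(n,m)+\zeta(m+n)$. The shuffle regularized values $\zeta_{\sqcup\!\sqcup}(m)\in\mathbb{R}[T]$ (for $m\in\mathbb{Z}_{>0}$) are defined as follows: as $\epsilon\to0$, $\sum_{k>0}(1-\epsilon)^k/k^m\sim c_0+c_1(-\log\epsilon)$ with $c_i\in\mathbb{R}$, and $\zeta_{\sqcup\!\sqcup}(m):=c_0+c_1T$. In particular $\zeta_{\sqcup\!\sqcup}(1)=T$ and $\zeta_{\sqcup\!\sqcup}(m)=\zeta(m)$ for $m>1$. The identity is an equality in $\mathbb{R}[T]$ (the $T$-terms cancel). -}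

module Defs where

open import Algebra.Bundles.Raw using (RawSemiring)
import Algebra.Definitions.RawSemiring as RawSemiringDefs
open import Data.Fin.Base using (Fin; toℕ)
open import Data.Fin.Properties using (toℕ<n)
open import Data.Integer.Base as ℤ using (ℤ; +_; +[1+_]; -1ℤ)
import Data.Integer.Properties as ℤₚ
open import Data.List.Base as List using (List; []; _∷_)
open import Data.Nat.Base as ℕ using (ℕ; zero; suc; z≤n; s≤s; _∸_)
open import Data.Nat.Combinatorics using (_C_)
import Data.Nat.Properties as ℕₚ
open import Data.Product.Base using (∃; _×_; _,_)
open import Data.Rational.Base as ℚ using (ℚ; 0ℚ; 1ℚ; ½; mkℚ; toℚᵘ)
import Data.Rational.Properties as ℚₚ
open import Data.Rational.Solver using (module +-*-Solver)
open import Data.Rational.Unnormalised.Base as ℚᵘ using (mkℚᵘ; *≡*; *<*)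
import Data.Rational.Unnormalised.Properties as ℚᵘₚ
open import Data.Sum.Base using (inj₁; inj₂)
import Data.Vec.Functional as Vector
open import Level using (0ℓ)
open import Relation.Binary.PropositionalEquality using (_≡_; refl; sym; trans; cong; cong₂; subst; subst₂; module ≡-Reasoning)
open import Relation.Nullary using (yes; no; contradiction)

------------------------------------------------------------------------
-- Rational estimates

open +-*-Solver using (solve; _:+_; _:*_; :-_; _:-_; con; _:=_)

0≤* : ∀ {p q} → 0ℚ ℚ.≤ p → 0ℚ ℚ.≤ q → 0ℚ ℚ.≤ p ℚ.* q
0≤* {p} {q} 0≤p 0≤q = ℚₚ.nonNegative⁻¹ (p ℚ.* q) {{ℚₚ.nonNeg*nonNeg⇒nonNeg p {{ℚ.nonNegative 0≤p}} q {{ℚ.nonNegative 0≤q}}}}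

0<* : ∀ {p q} → 0ℚ ℚ.< p → 0ℚ ℚ.< q → 0ℚ ℚ.< p ℚ.* q
0<* {p} {q} 0<p 0<q = ℚₚ.positive⁻¹ (p ℚ.* q) {{ℚₚ.pos*pos⇒pos p {{ℚ.positive 0<p}} q {{ℚ.positive 0<q}}}}

0≤+ : ∀ {p q} → 0ℚ ℚ.≤ p → 0ℚ ℚ.≤ q → 0ℚ ℚ.≤ p ℚ.+ q
0≤+ = ℚₚ.+-mono-≤

0<1 : 0ℚ ℚ.< 1ℚ
0<1 = ℚₚ.positive⁻¹ 1ℚ

0≤1 : 0ℚ ℚ.≤ 1ℚ
0≤1 = ℚₚ.<⇒≤ 0<1

*-mono-≤ : ∀ {p q r s} → 0ℚ ℚ.≤ r → 0ℚ ℚ.≤ q → p ℚ.≤ q → r ℚ.≤ s → p ℚ.* r ℚ.≤ q ℚ.* s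
*-mono-≤ {p} {q} {r} {s} 0≤r 0≤q p≤q r≤s =
  ℚₚ.≤-trans (ℚₚ.*-monoʳ-≤-nonNeg r {{ℚ.nonNegative 0≤r}} p≤q)
             (ℚₚ.*-monoˡ-≤-nonNeg q {{ℚ.nonNegative 0≤q}} r≤s)

0≤-⇒≤ : ∀ {p q} → 0ℚ ℚ.≤ q ℚ.- p → p ℚ.≤ q
0≤-⇒≤ {p} {q} h = subst₂ ℚ._≤_ (ℚₚ.+-identityˡ p)
  (solve 2 (λ p q → (q :- p) :+ p := q) refl p q) (ℚₚ.+-monoˡ-≤ p h)

≤⇒0≤- : ∀ {p q} → p ℚ.≤ q → 0ℚ ℚ.≤ q ℚ.- p
≤⇒0≤- {p} {q} h = subst (ℚ._≤ q ℚ.- p) (ℚₚ.+-inverseʳ p) (ℚₚ.+-monoˡ-≤ (ℚ.- p) h)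

p≤p+q : ∀ {p q} → 0ℚ ℚ.≤ q → p ℚ.≤ p ℚ.+ q
p≤p+q {p} {q} 0≤q = subst (ℚ._≤ p ℚ.+ q) (ℚₚ.+-identityʳ p) (ℚₚ.+-monoʳ-≤ p 0≤q)

0<½* : ∀ {ε} → 0ℚ ℚ.< ε → 0ℚ ℚ.< ½ ℚ.* ε
0<½* = 0<* (ℚₚ.positive⁻¹ ½)

½+½ : ∀ ε → ½ ℚ.* ε ℚ.+ ½ ℚ.* ε ≡ ε
½+½ ε = solve 1 (λ e → con ½ :* e :+ con ½ :* e := e) refl ε

∣-∣≤ : ∀ {p q} → p ℚ.≤ q → ℚ.- p ℚ.≤ q → ℚ.∣ p ∣ ℚ.≤ q
∣-∣≤ {p} {q} h₁ h₂ with ℚₚ.∣p∣≡p∨∣p∣≡-p p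
... | inj₁ e = subst (ℚ._≤ q) (sym e) h₁
... | inj₂ e = subst (ℚ._≤ q) (sym e) h₂

∣p-q∣≡∣q-p∣ : ∀ p q → ℚ.∣ p ℚ.- q ∣ ≡ ℚ.∣ q ℚ.- p ∣
∣p-q∣≡∣q-p∣ p q = trans (cong ℚ.∣_∣ (solve 2 (λ p q → p :- q := :- (q :- p)) refl p q)) (ℚₚ.∣-p∣≡∣p∣ (q ℚ.- p))

p≤∣p∣ : ∀ p → p ℚ.≤ ℚ.∣ p ∣
p≤∣p∣ p with ℚₚ.≤-total 0ℚ p
... | inj₁ 0≤p = ℚₚ.≤-reflexive (sym (ℚₚ.0≤p⇒∣p∣≡p 0≤p))
... | inj₂ p≤0 = ℚₚ.≤-trans p≤0 (ℚₚ.0≤∣p∣ p)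

∣p∣≤∣q∣+∣p-q∣ : ∀ p q → ℚ.∣ p ∣ ℚ.≤ ℚ.∣ q ∣ ℚ.+ ℚ.∣ p ℚ.- q ∣
∣p∣≤∣q∣+∣p-q∣ p q = subst (λ t → ℚ.∣ t ∣ ℚ.≤ ℚ.∣ q ∣ ℚ.+ ℚ.∣ p ℚ.- q ∣)
  (solve 2 (λ p q → q :+ (p :- q) := p) refl p q) (ℚₚ.∣p+q∣≤∣p∣+∣q∣ q (p ℚ.- q))

∣∣p∣-∣q∣∣≤∣p-q∣ : ∀ p q → ℚ.∣ ℚ.∣ p ∣ ℚ.- ℚ.∣ q ∣ ∣ ℚ.≤ ℚ.∣ p ℚ.- q ∣
∣∣p∣-∣q∣∣≤∣p-q∣ p q = ∣-∣≤ (half p q)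
  (subst₂ ℚ._≤_ (solve 2 (λ a b → b :- a := :- (a :- b)) refl ℚ.∣ p ∣ ℚ.∣ q ∣) (∣p-q∣≡∣q-p∣ q p) (half q p))
  where
  half : ∀ p q → ℚ.∣ p ∣ ℚ.- ℚ.∣ q ∣ ℚ.≤ ℚ.∣ p ℚ.- q ∣
  half p q = subst (ℚ.∣ p ∣ ℚ.- ℚ.∣ q ∣ ℚ.≤_)
    (solve 2 (λ a b → a :+ b :- a := b) refl ℚ.∣ q ∣ ℚ.∣ p ℚ.- q ∣)
    (ℚₚ.+-monoˡ-≤ (ℚ.- ℚ.∣ q ∣) (∣p∣≤∣q∣+∣p-q∣ p q))

-- The quotient ε / B, as a positive ε′ with B ε′ = ε.
shrink : ∀ {ε B} → 0ℚ ℚ.< ε → 0ℚ ℚ.< B → ∃ λ ε′ → 0ℚ ℚ.< ε′ × B ℚ.* ε′ ≡ ε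
shrink {ε} {B} 0<ε 0<B = ε′ , 0<* 0<ε (ℚₚ.positive⁻¹ _ {{ℚₚ.1/pos⇒pos B}}) , eq
  where
  instance
    B-pos : ℚ.Positive B
    B-pos = ℚ.positive 0<B
    B-nonZero : ℚ.NonZero B
    B-nonZero = ℚ.>-nonZero 0<B
  ε′ = ε ℚ.* (ℚ.1/ B)
  eq : B ℚ.* ε′ ≡ ε
  eq = trans (solve 3 (λ b e i → b :* (e :* i) := e :* (b :* i)) refl B ε (ℚ.1/ B))
       (trans (cong (ε ℚ.*_) (ℚₚ.*-inverseʳ B)) (ℚₚ.*-identityʳ ε))

------------------------------------------------------------------------
-- Real numbers: Cauchy sequences of rationals

Eventually : (ℕ → Set) → Set
Eventually A = ∃ λ N → ∀ p → N ℕ.≤ p → A p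

IsCauchy : (ℕ → ℚ) → Set
IsCauchy a = ∀ ε → 0ℚ ℚ.< ε → ∃ λ N → ∀ p q → N ℕ.≤ p → N ℕ.≤ q → ℚ.∣ a p ℚ.- a q ∣ ℚ.< ε

IsNull : (ℕ → ℚ) → Set
IsNull a = ∀ ε → 0ℚ ℚ.< ε → Eventually λ p → ℚ.∣ a p ∣ ℚ.< ε

record ℝ : Set where
  constructor mkℝ
  field
    seq    : ℕ → ℚ
    cauchy : IsCauchy seq

open ℝ public

infix 4 _≈_ _<_

_≈_ : ℝ → ℝ → Set
x ≈ y = IsNull λ p → seq x p ℚ.- seq y p

_<_ : ℝ → ℝ → Set
x < y = ∃ λ δ → 0ℚ ℚ.< δ × Eventually λ p → seq x p ℚ.+ δ ℚ.< seq y p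

fromℚ : ℚ → ℝ
fromℚ c .seq _ = c
fromℚ c .cauchy ε 0<ε = 0 , λ _ _ _ _ → subst (λ t → ℚ.∣ t ∣ ℚ.< ε) (sym (ℚₚ.+-inverseʳ c)) 0<ε

fromℤ : ℤ → ℝ
fromℤ z = fromℚ (z ℚ./ 1)

0ℝ 1ℝ : ℝ
0ℝ = fromℚ 0ℚ
1ℝ = fromℚ 1ℚ

infixl 6 _+_ _-_
infixl 7 _*_
infix 8 -_

_+_ : ℝ → ℝ → ℝ
(x + y) .seq p = seq x p ℚ.+ seq y p
(x + y) .cauchy ε 0<ε = proof (cauchy x (½ ℚ.* ε) (0<½* 0<ε)) (cauchy y (½ ℚ.* ε) (0<½* 0<ε))
  where
  proof : _ → _ → _
  proof (N₁ , h₁) (N₂ , h₂) = N₁ ℕ.⊔ N₂ , λ p q N≤p N≤q →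
    ℚₚ.≤-<-trans
      (subst (λ t → ℚ.∣ t ∣ ℚ.≤ ℚ.∣ seq x p ℚ.- seq x q ∣ ℚ.+ ℚ.∣ seq y p ℚ.- seq y q ∣)
        (solve 4 (λ a b c d → (a :- b) :+ (c :- d) := (a :+ c) :- (b :+ d)) refl (seq x p) (seq x q) (seq y p) (seq y q))
        (ℚₚ.∣p+q∣≤∣p∣+∣q∣ (seq x p ℚ.- seq x q) (seq y p ℚ.- seq y q)))
      (subst (ℚ.∣ seq x p ℚ.- seq x q ∣ ℚ.+ ℚ.∣ seq y p ℚ.- seq y q ∣ ℚ.<_) (½+½ ε)
        (ℚₚ.+-mono-< (h₁ p q (ℕₚ.m⊔n≤o⇒m≤o N₁ N₂ N≤p) (ℕₚ.m⊔n≤o⇒m≤o N₁ N₂ N≤q))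
                     (h₂ p q (ℕₚ.m⊔n≤o⇒n≤o N₁ N₂ N≤p) (ℕₚ.m⊔n≤o⇒n≤o N₁ N₂ N≤q))))

-_ : ℝ → ℝ
(- x) .seq p = ℚ.- seq x p
(- x) .cauchy ε 0<ε = proof (cauchy x ε 0<ε)
  where
  proof : _ → _
  proof (N , h) = N , λ p q N≤p N≤q → subst (ℚ._< ε)
    (trans (∣p-q∣≡∣q-p∣ (seq x p) (seq x q))
      (cong ℚ.∣_∣ (solve 2 (λ a b → b :- a := (:- a) :- (:- b)) refl (seq x p) (seq x q))))
    (h p q N≤p N≤q)

_-_ : ℝ → ℝ → ℝ
x - y = x + (- y)

∣_∣ : ℝ → ℝ
∣ x ∣ .seq p = ℚ.∣ seq x p ∣
∣ x ∣ .cauchy ε 0<ε = proof (cauchy x ε 0<ε)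
  where
  proof : _ → _
  proof (N , h) = N , λ p q N≤p N≤q → ℚₚ.≤-<-trans (∣∣p∣-∣q∣∣≤∣p-q∣ (seq x p) (seq x q)) (h p q N≤p N≤q)

eventuallyBounded : ∀ x → ∃ λ B → 0ℚ ℚ.< B × Eventually λ p → ℚ.∣ seq x p ∣ ℚ.≤ B
eventuallyBounded x = proof (cauchy x 1ℚ 0<1)
  where
  proof : _ → _
  proof (N , h) = ℚ.∣ seq x N ∣ ℚ.+ 1ℚ , ℚₚ.+-mono-≤-< (ℚₚ.0≤∣p∣ (seq x N)) 0<1 , N , λ p N≤p →
    ℚₚ.≤-trans (∣p∣≤∣q∣+∣p-q∣ (seq x p) (seq x N))
               (ℚₚ.+-monoʳ-≤ ℚ.∣ seq x N ∣ (ℚₚ.<⇒≤ (h p N N≤p ℕₚ.≤-refl)))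

_*_ : ℝ → ℝ → ℝ
(x * y) .seq p = seq x p ℚ.* seq y p
(x * y) .cauchy ε 0<ε = proof₁ (eventuallyBounded x) (eventuallyBounded y)
  where
  proof₁ : _ → _ → _
  proof₁ (B , 0<B , N₁ , h₁) (D , 0<D , N₂ , h₂) =
    proof₂ (shrink (0<½* 0<ε) 0<B) (shrink (0<½* 0<ε) 0<D)
    where
    proof₂ : _ → _ → _
    proof₂ (β , 0<β , Bβ≡½ε) (γ , 0<γ , Dγ≡½ε) = proof₃ (cauchy y β 0<β) (cauchy x γ 0<γ)
      where
      proof₃ : _ → _ → _
      proof₃ (N₃ , h₃) (N₄ , h₄) = (N₁ ℕ.⊔ N₂) ℕ.⊔ (N₃ ℕ.⊔ N₄) , bound
        where
        bound : ∀ p q → (N₁ ℕ.⊔ N₂) ℕ.⊔ (N₃ ℕ.⊔ N₄) ℕ.≤ p → (N₁ ℕ.⊔ N₂) ℕ.⊔ (N₃ ℕ.⊔ N₄) ℕ.≤ q →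
                ℚ.∣ seq x p ℚ.* seq y p ℚ.- seq x q ℚ.* seq y q ∣ ℚ.< ε
        bound p q N≤p N≤q = ℚₚ.≤-<-trans le (subst (u ℚ.* v ℚ.+ w ℚ.* z ℚ.<_) (½+½ ε) (ℚₚ.+-mono-< lt₁ lt₂))
          where
          xp = seq x p
          xq = seq x q
          yp = seq y p
          yq = seq y q
          u = ℚ.∣ xp ∣
          v = ℚ.∣ yp ℚ.- yq ∣
          w = ℚ.∣ yq ∣
          z = ℚ.∣ xp ℚ.- xq ∣
          le : ℚ.∣ xp ℚ.* yp ℚ.- xq ℚ.* yq ∣ ℚ.≤ u ℚ.* v ℚ.+ w ℚ.* z
          le = subst₂ ℚ._≤_
            (cong ℚ.∣_∣ (solve 4 (λ a b c d → a :* (c :- d) :+ d :* (a :- b) := a :* c :- b :* d) refl xp xq yp yq))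
            (cong₂ ℚ._+_ (ℚₚ.∣p*q∣≡∣p∣*∣q∣ xp (yp ℚ.- yq)) (ℚₚ.∣p*q∣≡∣p∣*∣q∣ yq (xp ℚ.- xq)))
            (ℚₚ.∣p+q∣≤∣p∣+∣q∣ (xp ℚ.* (yp ℚ.- yq)) (yq ℚ.* (xp ℚ.- xq)))
          u≤B : u ℚ.≤ B
          u≤B = h₁ p (ℕₚ.m⊔n≤o⇒m≤o N₁ N₂ (ℕₚ.m⊔n≤o⇒m≤o (N₁ ℕ.⊔ N₂) (N₃ ℕ.⊔ N₄) N≤p))
          w≤D : w ℚ.≤ D
          w≤D = h₂ q (ℕₚ.m⊔n≤o⇒n≤o N₁ N₂ (ℕₚ.m⊔n≤o⇒m≤o (N₁ ℕ.⊔ N₂) (N₃ ℕ.⊔ N₄) N≤q))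
          v<β : v ℚ.< β
          v<β = h₃ p q (ℕₚ.m⊔n≤o⇒m≤o N₃ N₄ (ℕₚ.m⊔n≤o⇒n≤o (N₁ ℕ.⊔ N₂) (N₃ ℕ.⊔ N₄) N≤p))
                       (ℕₚ.m⊔n≤o⇒m≤o N₃ N₄ (ℕₚ.m⊔n≤o⇒n≤o (N₁ ℕ.⊔ N₂) (N₃ ℕ.⊔ N₄) N≤q))
          z<γ : z ℚ.< γ
          z<γ = h₄ p q (ℕₚ.m⊔n≤o⇒n≤o N₃ N₄ (ℕₚ.m⊔n≤o⇒n≤o (N₁ ℕ.⊔ N₂) (N₃ ℕ.⊔ N₄) N≤p))
                       (ℕₚ.m⊔n≤o⇒n≤o N₃ N₄ (ℕₚ.m⊔n≤o⇒n≤o (N₁ ℕ.⊔ N₂) (N₃ ℕ.⊔ N₄) N≤q))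
          lt₁ : u ℚ.* v ℚ.< ½ ℚ.* ε
          lt₁ = subst (u ℚ.* v ℚ.<_) Bβ≡½ε
            (ℚₚ.≤-<-trans (ℚₚ.*-monoʳ-≤-nonNeg v {{ℚₚ.∣-∣-nonNeg (yp ℚ.- yq)}} u≤B)
                          (ℚₚ.*-monoʳ-<-pos B {{ℚ.positive 0<B}} v<β))
          lt₂ : w ℚ.* z ℚ.< ½ ℚ.* ε
          lt₂ = subst (w ℚ.* z ℚ.<_) Dγ≡½ε
            (ℚₚ.≤-<-trans (ℚₚ.*-monoʳ-≤-nonNeg z {{ℚₚ.∣-∣-nonNeg (xp ℚ.- xq)}} w≤D)
                          (ℚₚ.*-monoʳ-<-pos D {{ℚ.positive 0<D}} z<γ))

ℝ-rawSemiring : RawSemiring 0ℓ 0ℓ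
ℝ-rawSemiring = record
  { Carrier = ℝ ; _≈_ = _≈_ ; _+_ = _+_ ; _*_ = _*_ ; 0# = 0ℝ ; 1# = 1ℝ }

module ℚ^ = RawSemiringDefs ℚ.+-*-rawSemiring using (_^_)

open RawSemiringDefs ℝ-rawSemiring public using (_^_)

recipℚ : ℚ → ℚ
recipℚ q with q ℚₚ.≟ 0ℚ
... | yes _  = 0ℚ
... | no q≢0 = (ℚ.1/ q) {{ℚ.≢-nonZero q≢0}}

recipℚ-inverse : ∀ {q} → 0ℚ ℚ.< q → recipℚ q ℚ.* q ≡ 1ℚ
recipℚ-inverse {q} 0<q with q ℚₚ.≟ 0ℚ
... | yes q≡0 = contradiction (sym q≡0) (ℚₚ.<⇒≢ 0<q)
... | no q≢0  = ℚₚ.*-inverseˡ q {{ℚ.≢-nonZero q≢0}}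

recipℚ-pos : ∀ {q} → 0ℚ ℚ.< q → 0ℚ ℚ.< recipℚ q
recipℚ-pos {q} 0<q with q ℚₚ.≟ 0ℚ
... | yes q≡0 = contradiction (sym q≡0) (ℚₚ.<⇒≢ 0<q)
... | no q≢0  = ℚₚ.positive⁻¹ _ {{ℚₚ.1/pos⇒pos q {{ℚ.positive 0<q}}}}

recipℚ-antimono : ∀ {p q} → 0ℚ ℚ.< p → p ℚ.≤ q → recipℚ q ℚ.≤ recipℚ p
recipℚ-antimono {p} {q} 0<p p≤q = subst₂ ℚ._≤_
  (trans (solve 3 (λ r p s → r :* p :* s := r :* (s :* p)) refl (recipℚ q) p (recipℚ p))
    (trans (cong (recipℚ q ℚ.*_) (recipℚ-inverse 0<p)) (ℚₚ.*-identityʳ (recipℚ q))))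
  (trans (cong (ℚ._* recipℚ p) (recipℚ-inverse 0<q)) (ℚₚ.*-identityˡ (recipℚ p)))
  (ℚₚ.*-monoʳ-≤-nonNeg (recipℚ p) {{ℚ.nonNegative (ℚₚ.<⇒≤ (recipℚ-pos 0<p))}}
    (ℚₚ.*-monoˡ-≤-nonNeg (recipℚ q) {{ℚ.nonNegative (ℚₚ.<⇒≤ (recipℚ-pos 0<q))}} p≤q))
  where
  0<q = ℚₚ.<-≤-trans 0<p p≤q

recip : (x : ℝ) → 0ℝ < x → ℝ
recip x _ .seq p = recipℚ (seq x p)
recip x (δ , 0<δ , N₁ , h₁) .cauchy ε 0<ε = proof₁ (shrink 0<ε (0<* 0<R 0<R))
  where
  R = recipℚ δ
  0<R = recipℚ-pos 0<δ
  proof₁ : _ → _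
  proof₁ (γ , 0<γ , RRγ≡ε) = proof₂ (cauchy x γ 0<γ)
    where
    proof₂ : _ → _
    proof₂ (N₂ , h₂) = N₁ ℕ.⊔ N₂ , bound
      where
      bound : ∀ p q → N₁ ℕ.⊔ N₂ ℕ.≤ p → N₁ ℕ.⊔ N₂ ℕ.≤ q → ℚ.∣ recipℚ (seq x p) ℚ.- recipℚ (seq x q) ∣ ℚ.< ε
      bound p q N≤p N≤q = subst₂ ℚ._<_ (sym eq) RRγ≡ε
        (ℚₚ.≤-<-trans (ℚₚ.*-monoʳ-≤-nonNeg z {{ℚₚ.∣-∣-nonNeg (b ℚ.- a)}}
                        (*-mono-≤ (ℚₚ.<⇒≤ 0<rb) (ℚₚ.<⇒≤ 0<R) (recipℚ-antimono 0<δ δ≤a) (recipℚ-antimono 0<δ δ≤b)))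
                      (ℚₚ.*-monoʳ-<-pos (R ℚ.* R) {{ℚ.positive (0<* 0<R 0<R)}}
                        (h₂ q p (ℕₚ.m⊔n≤o⇒n≤o N₁ N₂ N≤q) (ℕₚ.m⊔n≤o⇒n≤o N₁ N₂ N≤p))))
        where
        a = seq x p
        b = seq x q
        ra = recipℚ a
        rb = recipℚ b
        z = ℚ.∣ b ℚ.- a ∣
        δ≤a : δ ℚ.≤ a
        δ≤a = subst (ℚ._≤ a) (ℚₚ.+-identityˡ δ) (ℚₚ.<⇒≤ (h₁ p (ℕₚ.m⊔n≤o⇒m≤o N₁ N₂ N≤p)))
        δ≤b : δ ℚ.≤ b
        δ≤b = subst (ℚ._≤ b) (ℚₚ.+-identityˡ δ) (ℚₚ.<⇒≤ (h₁ q (ℕₚ.m⊔n≤o⇒m≤o N₁ N₂ N≤q)))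
        0<a = ℚₚ.<-≤-trans 0<δ δ≤a
        0<b = ℚₚ.<-≤-trans 0<δ δ≤b
        0<ra = recipℚ-pos 0<a
        0<rb = recipℚ-pos 0<b
        diff : ra ℚ.- rb ≡ ra ℚ.* rb ℚ.* (b ℚ.- a)
        diff = sym (trans
          (solve 4 (λ a b r s → r :* s :* (b :- a) := r :* (s :* b) :- s :* (r :* a)) refl a b ra rb)
          (cong₂ ℚ._-_ (trans (cong (ra ℚ.*_) (recipℚ-inverse 0<b)) (ℚₚ.*-identityʳ ra))
                       (trans (cong (rb ℚ.*_) (recipℚ-inverse 0<a)) (ℚₚ.*-identityʳ rb))))
        eq : ℚ.∣ ra ℚ.- rb ∣ ≡ ra ℚ.* rb ℚ.* z
        eq = trans (cong ℚ.∣_∣ diff)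
             (trans (ℚₚ.∣p*q∣≡∣p∣*∣q∣ (ra ℚ.* rb) (b ℚ.- a))
                    (cong (ℚ._* z) (ℚₚ.0≤p⇒∣p∣≡p (0≤* (ℚₚ.<⇒≤ 0<ra) (ℚₚ.<⇒≤ 0<rb)))))

------------------------------------------------------------------------
-- Series.  Terms are indexed from 0, so index k stands for the summand
-- with summation variable k + 1 whenever the latter starts at 1.

∑ℚ : (ℕ → ℚ) → ℕ → ℚ
∑ℚ f zero    = 0ℚ
∑ℚ f (suc N) = ∑ℚ f N ℚ.+ f N

∑ℝ : (ℕ → ℝ) → ℕ → ℝ
∑ℝ f zero    = 0ℝ
∑ℝ f (suc N) = ∑ℝ f N + f N

infix 4 _⟶_

_⟶_ : (ℕ → ℝ) → ℝ → Set
a ⟶ x = ∀ δ → 0ℝ < δ → Eventually λ N → ∣ a N - x ∣ < δ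

HasSum : (ℕ → ℝ) → ℝ → Set
HasSum f s = ∑ℝ f ⟶ s

∑∞ : (f : ℕ → ℚ) → IsCauchy (∑ℚ f) → ℝ
∑∞ f c = mkℝ (∑ℚ f) c

-- 1/(k+1)
unit : ℕ → ℚ
unit k = + 1 ℚ./ suc k

-- (k+1)^{-m}
term : ℕ → ℕ → ℚ
term m k = unit k ℚ^.^ m

------------------------------------------------------------------------
-- Convergence of the zeta series

ι : ℕ → ℚ
ι n = + n ℚ./ 1

toℚᵘ-/ : ∀ z n → toℚᵘ (z ℚ./ suc n) ℚᵘ.≃ mkℚᵘ z n
toℚᵘ-/ z n = ℚₚ.toℚᵘ-fromℚᵘ (mkℚᵘ z n)

ι-suc : ∀ n → ι (suc n) ≡ ι n ℚ.+ 1ℚ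
ι-suc n = ℚₚ.toℚᵘ-injective (ℚᵘₚ.≃-trans (toℚᵘ-/ (+ suc n) 0)
  (ℚᵘₚ.≃-sym (ℚᵘₚ.≃-trans (ℚₚ.toℚᵘ-homo-+ (ι n) 1ℚ)
    (ℚᵘₚ.≃-trans (ℚᵘₚ.+-congˡ (toℚᵘ 1ℚ) (toℚᵘ-/ (+ n) 0)) (*≡* eq)))))
  where
  eq : (+ n ℤ.* + 1 ℤ.+ + 1 ℤ.* + 1) ℤ.* + 1 ≡ + suc n ℤ.* (+ 1 ℤ.* + 1)
  eq = trans (ℤₚ.*-identityʳ _) (trans (cong (ℤ._+ + 1) (ℤₚ.*-identityʳ (+ n)))
         (trans (cong +_ (ℕₚ.+-comm n 1)) (sym (ℤₚ.*-identityʳ (+ suc n)))))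

unit-ι : ∀ k → unit k ℚ.* ι (suc k) ≡ 1ℚ
unit-ι k = ℚₚ.toℚᵘ-injective (ℚᵘₚ.≃-trans (ℚₚ.toℚᵘ-homo-* (unit k) (ι (suc k)))
  (ℚᵘₚ.≃-trans (ℚᵘₚ.*-cong (toℚᵘ-/ (+ 1) k) (toℚᵘ-/ (+ suc k) 0)) (*≡* eq)))
  where
  eq : (+ 1 ℤ.* + suc k) ℤ.* + 1 ≡ + 1 ℤ.* (+ suc k ℤ.* + 1)
  eq = ℤₚ.*-assoc (+ 1) (+ suc k) (+ 1)

0<unit : ∀ k → 0ℚ ℚ.< unit k
0<unit k = ℚₚ.positive⁻¹ (unit k) {{ℚₚ.normalize-pos 1 (suc k)}}

0≤unit : ∀ k → 0ℚ ℚ.≤ unit k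
0≤unit k = ℚₚ.<⇒≤ (0<unit k)

0≤ι : ∀ n → 0ℚ ℚ.≤ ι n
0≤ι n = ℚₚ.nonNegative⁻¹ (ι n) {{ℚₚ.normalize-nonNeg n 1}}

unit-diff : ∀ k → unit k ℚ.- unit (suc k) ≡ unit k ℚ.* unit (suc k)
unit-diff k = begin
  s ℚ.- s′                                          ≡⟨ cong₂ ℚ._-_ (sym (ℚₚ.*-identityʳ s)) (sym (ℚₚ.*-identityʳ s′)) ⟩
  s ℚ.* 1ℚ ℚ.- s′ ℚ.* 1ℚ                            ≡⟨ cong₂ (λ a b → s ℚ.* a ℚ.- s′ ℚ.* b) (sym one′) (sym (unit-ι k)) ⟩
  s ℚ.* (s′ ℚ.* (κ ℚ.+ 1ℚ)) ℚ.- s′ ℚ.* (s ℚ.* κ)    ≡⟨ solve 3 (λ s t κ → s :* (t :* (κ :+ con 1ℚ)) :- t :* (s :* κ) := s :* t) refl s s′ κ ⟩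
  s ℚ.* s′                                          ∎
  where
  open ≡-Reasoning
  s = unit k
  s′ = unit (suc k)
  κ = ι (suc k)
  one′ : s′ ℚ.* (κ ℚ.+ 1ℚ) ≡ 1ℚ
  one′ = trans (cong (s′ ℚ.*_) (sym (ι-suc (suc k)))) (unit-ι (suc k))

unit-step : ∀ k → unit (suc k) ℚ.≤ unit k
unit-step k = 0≤-⇒≤ (subst (0ℚ ℚ.≤_) (sym (unit-diff k)) (0≤* (0≤unit k) (0≤unit (suc k))))

unit-+ : ∀ k d → unit (d ℕ.+ k) ℚ.≤ unit k
unit-+ k zero    = ℚₚ.≤-refl
unit-+ k (suc d) = ℚₚ.≤-trans (unit-step (d ℕ.+ k)) (unit-+ k d)

unit-antimono : ∀ {j k} → j ℕ.≤ k → unit k ℚ.≤ unit j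
unit-antimono {j} {k} j≤k = subst (λ t → unit t ℚ.≤ unit j) (ℕₚ.m∸n+n≡m j≤k) (unit-+ j (k ∸ j))

unit≤1 : ∀ k → unit k ℚ.≤ 1ℚ
unit≤1 k = unit-antimono {0} {k} z≤n

archimedean : ∀ ε → 0ℚ ℚ.< ε → ∃ λ M → unit M ℚ.< ε
archimedean ε 0<ε = go ε (ℚ.positive 0<ε)
  where
  go : ∀ ε → ℚ.Positive ε → ∃ λ M → unit M ℚ.< ε
  go ε@(mkℚ +[1+ n ] d _) _ = suc d , ℚₚ.toℚᵘ-cancel-<
    (ℚᵘₚ.<-respˡ-≃ (ℚᵘₚ.≃-sym (toℚᵘ-/ (+ 1) (suc d))) (*<* lt))
    where
    lt : + 1 ℤ.* + suc d ℤ.< +[1+ n ] ℤ.* + suc (suc d)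
    lt = subst₂ ℤ._<_ (ℤₚ.pos-* 1 (suc d)) (ℤₚ.pos-* (suc n) (suc (suc d))) (ℤ.+<+ (ℕₚ.≤-<-trans (ℕₚ.*-monoˡ-≤ (suc d) (s≤s (z≤n {n}))) (ℕₚ.*-monoʳ-< (suc n) (ℕₚ.n<1+n (suc d)))))

0<+ : ∀ {p q} → 0ℚ ℚ.< p → 0ℚ ℚ.≤ q → 0ℚ ℚ.< p ℚ.+ q
0<+ = ℚₚ.+-mono-<-≤

unit-scaled-null : ∀ B → 0ℚ ℚ.< B → ∀ ε → 0ℚ ℚ.< ε → Eventually λ k → B ℚ.* unit k ℚ.< ε
unit-scaled-null B 0<B ε 0<ε = proof₁ (shrink 0<ε 0<B)
  where
  proof₁ : _ → _
  proof₁ (γ , 0<γ , Bγ≡ε) = proof₂ (archimedean γ 0<γ)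
    where
    proof₂ : _ → _
    proof₂ (M , unit<γ) = M , λ k M≤k → subst (B ℚ.* unit k ℚ.<_) Bγ≡ε
      (ℚₚ.*-monoʳ-<-pos B {{ℚ.positive 0<B}} (ℚₚ.≤-<-trans (unit-antimono M≤k) unit<γ))

∑ℚ-mono : ∀ {f g} → (∀ k → f k ℚ.≤ g k) → ∀ N → ∑ℚ f N ℚ.≤ ∑ℚ g N
∑ℚ-mono f≤g zero    = ℚₚ.≤-refl
∑ℚ-mono f≤g (suc N) = ℚₚ.+-mono-≤ (∑ℚ-mono f≤g N) (f≤g N)

∑ℚ-nonNeg : ∀ {f} → (∀ k → 0ℚ ℚ.≤ f k) → ∀ N → 0ℚ ℚ.≤ ∑ℚ f N
∑ℚ-nonNeg 0≤f zero    = ℚₚ.≤-refl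
∑ℚ-nonNeg 0≤f (suc N) = 0≤+ (∑ℚ-nonNeg 0≤f N) (0≤f N)

H : ℕ → ℚ
H = ∑ℚ unit

0≤H : ∀ N → 0ℚ ℚ.≤ H N
0≤H = ∑ℚ-nonNeg 0≤unit

H≤ι : ∀ N → H N ℚ.≤ ι N
H≤ι zero    = ℚₚ.≤-refl
H≤ι (suc N) = subst (H (suc N) ℚ.≤_) (sym (ι-suc N)) (ℚₚ.+-mono-≤ (H≤ι N) (unit≤1 N))

H-bound-+ : ∀ M d → H (d ℕ.+ M) ℚ.≤ ι M ℚ.+ ι (d ℕ.+ M) ℚ.* unit M
H-bound-+ M zero    = ℚₚ.≤-trans (H≤ι M) (p≤p+q (0≤* (0≤ι M) (0≤unit M)))
H-bound-+ M (suc d) = subst (H (suc d ℕ.+ M) ℚ.≤_)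
  (trans (solve 3 (λ a b c → (a :+ b :* c) :+ c := a :+ (b :+ con 1ℚ) :* c) refl (ι M) (ι (d ℕ.+ M)) (unit M))
         (cong (λ t → ι M ℚ.+ t ℚ.* unit M) (sym (ι-suc (d ℕ.+ M)))))
  (ℚₚ.+-mono-≤ (H-bound-+ M d) (unit-+ M d))

H-bound : ∀ M {N} → M ℕ.≤ N → H N ℚ.≤ ι M ℚ.+ ι N ℚ.* unit M
H-bound M {N} M≤N = subst (λ t → H t ℚ.≤ ι M ℚ.+ ι t ℚ.* unit M) (ℕₚ.m∸n+n≡m M≤N) (H-bound-+ M (N ∸ M))

2ℚ : ℚ
2ℚ = 1ℚ ℚ.+ 1ℚ

majorant : ℕ → ℚ
majorant k = 2ℚ ℚ.* ((H k ℚ.+ 2ℚ) ℚ.* unit k)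

0≤majorant : ∀ k → 0ℚ ℚ.≤ majorant k
0≤majorant k = 0≤* (0≤+ 0≤1 0≤1) (0≤* (0≤+ (0≤H k) (0≤+ 0≤1 0≤1)) (0≤unit k))

ι*unit≤1 : ∀ k → ι k ℚ.* unit k ℚ.≤ 1ℚ
ι*unit≤1 k = subst (ι k ℚ.* unit k ℚ.≤_)
  (trans (ℚₚ.*-comm (ι (suc k)) (unit k)) (unit-ι k))
  (ℚₚ.*-monoʳ-≤-nonNeg (unit k) {{ℚ.nonNegative (0≤unit k)}}
    (subst (ι k ℚ.≤_) (sym (ι-suc k)) (p≤p+q 0≤1)))

majorant-bound : ∀ M k → M ℕ.≤ k → majorant k ℚ.≤ 2ℚ ℚ.* ((2ℚ ℚ.+ ι M) ℚ.* unit k ℚ.+ unit M)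
majorant-bound M k M≤k = ℚₚ.*-monoˡ-≤-nonNeg 2ℚ {{ℚ.nonNegative (0≤+ 0≤1 0≤1)}}
  (ℚₚ.≤-trans
    (ℚₚ.*-monoʳ-≤-nonNeg (unit k) {{ℚ.nonNegative (0≤unit k)}} (ℚₚ.+-monoˡ-≤ 2ℚ (H-bound M M≤k)))
    (subst₂ ℚ._≤_
      (solve 4 (λ a b c d → (con 2ℚ :+ a) :* d :+ (b :* d) :* c := ((a :+ b :* c) :+ con 2ℚ) :* d) refl (ι M) (ι k) (unit M) (unit k))
      (cong ((2ℚ ℚ.+ ι M) ℚ.* unit k ℚ.+_) (ℚₚ.*-identityˡ (unit M)))
      (ℚₚ.+-monoʳ-≤ ((2ℚ ℚ.+ ι M) ℚ.* unit k)
        (ℚₚ.*-monoʳ-≤-nonNeg (unit M) {{ℚ.nonNegative (0≤unit M)}} (ι*unit≤1 k)))))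

majorant-null : ∀ ε → 0ℚ ℚ.< ε → Eventually λ k → majorant k ℚ.< ε
majorant-null ε 0<ε = proof₁ (archimedean ε/4 0<ε/4)
  where
  ε/4 = ½ ℚ.* (½ ℚ.* ε)
  0<ε/4 = 0<½* (0<½* 0<ε)
  0<2 : 0ℚ ℚ.< 2ℚ
  0<2 = 0<+ 0<1 0≤1
  proof₁ : _ → _
  proof₁ (M , unit<) = proof₂ (unit-scaled-null (2ℚ ℚ.+ ι M) (0<+ 0<2 (0≤ι M)) ε/4 0<ε/4)
    where
    proof₂ : _ → _
    proof₂ (N , h) = M ℕ.⊔ N , λ k MN≤k →
      ℚₚ.≤-<-trans (majorant-bound M k (ℕₚ.m⊔n≤o⇒m≤o M N MN≤k))
        (subst (2ℚ ℚ.* ((2ℚ ℚ.+ ι M) ℚ.* unit k ℚ.+ unit M) ℚ.<_)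
          (solve 1 (λ e → con 2ℚ :* (con ½ :* (con ½ :* e) :+ con ½ :* (con ½ :* e)) := e) refl ε)
          (ℚₚ.*-monoʳ-<-pos 2ℚ {{ℚ.positive 0<2}} (ℚₚ.+-mono-< (h k (ℕₚ.m⊔n≤o⇒n≤o M N MN≤k)) unit<)))

majorant-telescopes : ∀ k → (H k ℚ.+ 1ℚ) ℚ.* (unit k ℚ.* unit k) ℚ.≤ majorant k ℚ.- majorant (suc k)
majorant-telescopes k = 0≤-⇒≤ (subst (0ℚ ℚ.≤_) (sym eq)
  (0≤* (0≤+ (0≤H k) 0≤1) (0≤* (0≤unit k) (subst (0ℚ ℚ.≤_) eq₁ (0≤* (≤⇒0≤- (unit≤1 k)) (0≤unit (suc k)))))))
  where
  h = H k
  s = unit k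
  s′ = unit (suc k)
  eq₁ : (1ℚ ℚ.- s) ℚ.* s′ ≡ 2ℚ ℚ.* s′ ℚ.- s
  eq₁ = begin
    (1ℚ ℚ.- s) ℚ.* s′       ≡⟨ solve 2 (λ s t → (con 1ℚ :- s) :* t := t :- s :* t) refl s s′ ⟩
    s′ ℚ.- s ℚ.* s′         ≡⟨ cong (λ t → s′ ℚ.- t) (sym (unit-diff k)) ⟩
    s′ ℚ.- (s ℚ.- s′)       ≡⟨ solve 2 (λ s t → t :- (s :- t) := con 2ℚ :* t :- s) refl s s′ ⟩
    2ℚ ℚ.* s′ ℚ.- s         ∎
    where open ≡-Reasoning
  eq : majorant k ℚ.- majorant (suc k) ℚ.- (h ℚ.+ 1ℚ) ℚ.* (s ℚ.* s) ≡ (h ℚ.+ 1ℚ) ℚ.* (s ℚ.* (2ℚ ℚ.* s′ ℚ.- s))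
  eq = begin
    majorant k ℚ.- majorant (suc k) ℚ.- (h ℚ.+ 1ℚ) ℚ.* (s ℚ.* s)
      ≡⟨ solve 3 (λ h s t → con 2ℚ :* ((h :+ con 2ℚ) :* s) :- con 2ℚ :* (((h :+ s) :+ con 2ℚ) :* t) :- (h :+ con 1ℚ) :* (s :* s)
                   := con 2ℚ :* ((h :+ con 2ℚ) :* (s :- t)) :- con 2ℚ :* (s :* t) :- (h :+ con 1ℚ) :* (s :* s)) refl h s s′ ⟩
    2ℚ ℚ.* ((h ℚ.+ 2ℚ) ℚ.* (s ℚ.- s′)) ℚ.- 2ℚ ℚ.* (s ℚ.* s′) ℚ.- (h ℚ.+ 1ℚ) ℚ.* (s ℚ.* s)
      ≡⟨ cong (λ t → 2ℚ ℚ.* ((h ℚ.+ 2ℚ) ℚ.* t) ℚ.- 2ℚ ℚ.* (s ℚ.* s′) ℚ.- (h ℚ.+ 1ℚ) ℚ.* (s ℚ.* s)) (unit-diff k) ⟩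
    2ℚ ℚ.* ((h ℚ.+ 2ℚ) ℚ.* (s ℚ.* s′)) ℚ.- 2ℚ ℚ.* (s ℚ.* s′) ℚ.- (h ℚ.+ 1ℚ) ℚ.* (s ℚ.* s)
      ≡⟨ solve 3 (λ h s t → con 2ℚ :* ((h :+ con 2ℚ) :* (s :* t)) :- con 2ℚ :* (s :* t) :- (h :+ con 1ℚ) :* (s :* s)
                   := (h :+ con 1ℚ) :* (s :* (con 2ℚ :* t :- s))) refl h s s′ ⟩
    (h ℚ.+ 1ℚ) ℚ.* (s ℚ.* (2ℚ ℚ.* s′ ℚ.- s))  ∎
    where open ≡-Reasoning

0≤term : ∀ m k → 0ℚ ℚ.≤ term m k
0≤term zero    k = 0≤1
0≤term (suc m) k = 0≤* (0≤unit k) (0≤term m k)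

term≤1 : ∀ m k → term m k ℚ.≤ 1ℚ
term≤1 zero    k = ℚₚ.≤-refl
term≤1 (suc m) k = *-mono-≤ (0≤term m k) 0≤1 (unit≤1 k) (term≤1 m k)

term≤unit : ∀ n k → 0 ℕ.< n → term n k ℚ.≤ unit k
term≤unit (suc n) k _ = subst (term (suc n) k ℚ.≤_) (ℚₚ.*-identityʳ (unit k))
  (ℚₚ.*-monoˡ-≤-nonNeg (unit k) {{ℚ.nonNegative (0≤unit k)}} (term≤1 n k))

term≤unit² : ∀ m k → 1 ℕ.< m → term m k ℚ.≤ unit k ℚ.* unit k
term≤unit² (suc m) k (s≤s 0<m) = ℚₚ.*-monoˡ-≤-nonNeg (unit k) {{ℚ.nonNegative (0≤unit k)}} (term≤unit m k 0<m)

converges : (f : ℕ → ℚ) → (∀ k → 0ℚ ℚ.≤ f k) →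
            (∀ k → f k ℚ.≤ (H k ℚ.+ 1ℚ) ℚ.* (unit k ℚ.* unit k)) → IsCauchy (∑ℚ f)
converges f 0≤f f≤ ε 0<ε = proof (majorant-null ε 0<ε)
  where
  S = ∑ℚ f
  increasing : ∀ N d → S N ℚ.≤ S (d ℕ.+ N)
  increasing N zero    = ℚₚ.≤-refl
  increasing N (suc d) = ℚₚ.≤-trans (increasing N d) (p≤p+q (0≤f (d ℕ.+ N)))
  telescope : ∀ N d → S (d ℕ.+ N) ℚ.+ majorant (d ℕ.+ N) ℚ.≤ S N ℚ.+ majorant N
  telescope N zero    = ℚₚ.≤-refl
  telescope N (suc d) = ℚₚ.≤-trans
    (subst (S (suc d ℕ.+ N) ℚ.+ majorant (suc d ℕ.+ N) ℚ.≤_)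
      (solve 3 (λ s a b → s :+ (a :- b) :+ b := s :+ a) refl (S (d ℕ.+ N)) (majorant (d ℕ.+ N)) (majorant (suc d ℕ.+ N)))
      (ℚₚ.+-monoˡ-≤ (majorant (suc d ℕ.+ N))
        (ℚₚ.+-monoʳ-≤ (S (d ℕ.+ N)) (ℚₚ.≤-trans (f≤ (d ℕ.+ N)) (majorant-telescopes (d ℕ.+ N))))))
    (telescope N d)
  lower : ∀ {N p} → N ℕ.≤ p → S N ℚ.≤ S p
  lower {N} {p} N≤p = subst (λ t → S N ℚ.≤ S t) (ℕₚ.m∸n+n≡m N≤p) (increasing N (p ∸ N))
  upper : ∀ {N p} → N ℕ.≤ p → S p ℚ.≤ S N ℚ.+ majorant N
  upper {N} {p} N≤p = ℚₚ.≤-trans (p≤p+q (0≤majorant p))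
    (subst (λ t → S t ℚ.+ majorant t ℚ.≤ S N ℚ.+ majorant N) (ℕₚ.m∸n+n≡m N≤p) (telescope N (p ∸ N)))
  close : ∀ {N p q} → N ℕ.≤ p → N ℕ.≤ q → S p ℚ.- S q ℚ.≤ majorant N
  close {N} {p} {q} N≤p N≤q = subst (S p ℚ.- S q ℚ.≤_)
    (solve 2 (λ a b → a :+ b :- a := b) refl (S N) (majorant N))
    (ℚₚ.+-mono-≤ (upper N≤p) (ℚₚ.neg-antimono-≤ (lower N≤q)))
  proof : _ → _
  proof (N , h) = N , λ p q N≤p N≤q → ℚₚ.≤-<-trans
    (∣-∣≤ (close N≤p N≤q)
      (subst (ℚ._≤ majorant N) (solve 2 (λ a b → b :- a := :- (a :- b)) refl (S p) (S q)) (close N≤q N≤p)))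
    (h N ℕₚ.≤-refl)

------------------------------------------------------------------------
-- Zeta values

ζ : (m : ℕ) → 1 ℕ.< m → ℝ
ζ m m>1 = ∑∞ (term m) (converges (term m) (0≤term m) bound)
  where
  bound : ∀ k → term m k ℚ.≤ (H k ℚ.+ 1ℚ) ℚ.* (unit k ℚ.* unit k)
  bound k = ℚₚ.≤-trans (term≤unit² m k m>1) (subst (ℚ._≤ (H k ℚ.+ 1ℚ) ℚ.* (unit k ℚ.* unit k))
    (ℚₚ.*-identityˡ (unit k ℚ.* unit k))
    (ℚₚ.*-monoʳ-≤-nonNeg (unit k ℚ.* unit k) {{ℚ.nonNegative (0≤* (0≤unit k) (0≤unit k))}}
      (subst (ℚ._≤ H k ℚ.+ 1ℚ) (ℚₚ.+-identityˡ 1ℚ) (ℚₚ.+-monoˡ-≤ 1ℚ (0≤H k)))))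

-- ∑_{0<k₁<k₂} k₁⁻ⁿ k₂⁻ᵐ, summed by k₂ = k+1; the inner sum is over 1 ≤ k₁ ≤ k.
ζ₂ : (n m : ℕ) → 0 ℕ.< n → 1 ℕ.< m → ℝ
ζ₂ n m n>0 m>1 = ∑∞ f (converges f 0≤f bound)
  where
  f : ℕ → ℚ
  f k = ∑ℚ (term n) k ℚ.* term m k
  0≤f : ∀ k → 0ℚ ℚ.≤ f k
  0≤f k = 0≤* (∑ℚ-nonNeg (0≤term n) k) (0≤term m k)
  bound : ∀ k → f k ℚ.≤ (H k ℚ.+ 1ℚ) ℚ.* (unit k ℚ.* unit k)
  bound k = *-mono-≤ (0≤term m k) (0≤+ (0≤H k) 0≤1)
    (ℚₚ.≤-trans (∑ℚ-mono (λ j → term≤unit n j n>0) k) (p≤p+q 0≤1)) (term≤unit² m k m>1)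

-- ∑_{0<k₁≤k₂} k₁⁻ⁿ k₂⁻ᵐ; the inner sum is over 1 ≤ k₁ ≤ k+1.
ζ⋆ : (n m : ℕ) → 0 ℕ.< n → 1 ℕ.< m → ℝ
ζ⋆ n m n>0 m>1 = ∑∞ f (converges f 0≤f bound)
  where
  f : ℕ → ℚ
  f k = ∑ℚ (term n) (suc k) ℚ.* term m k
  0≤f : ∀ k → 0ℚ ℚ.≤ f k
  0≤f k = 0≤* (∑ℚ-nonNeg (0≤term n) (suc k)) (0≤term m k)
  bound : ∀ k → f k ℚ.≤ (H k ℚ.+ 1ℚ) ℚ.* (unit k ℚ.* unit k)
  bound k = *-mono-≤ (0≤term m k) (0≤+ (0≤H k) 0≤1)
    (ℚₚ.≤-trans (∑ℚ-mono (λ j → term≤unit n j n>0) (suc k)) (ℚₚ.+-monoʳ-≤ (H k) (unit≤1 k))) (term≤unit² m k m>1)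

------------------------------------------------------------------------
-- Polynomials over ℝ in T, as coefficient lists (constant term first)

ℝ[T] : Set
ℝ[T] = List ℝ

coeff : ℝ[T] → ℕ → ℝ
coeff []      _       = 0ℝ
coeff (a ∷ _) zero    = a
coeff (_ ∷ p) (suc k) = coeff p k

infix 4 _≋_
infixl 6 _⊕_ _⊖_
infixr 7 _·_

_≋_ : ℝ[T] → ℝ[T] → Set
p ≋ q = ∀ k → coeff p k ≈ coeff q k

const : ℝ → ℝ[T]
const a = a ∷ []

_⊕_ : ℝ[T] → ℝ[T] → ℝ[T]
[]      ⊕ q       = q
(a ∷ p) ⊕ []      = a ∷ p
(a ∷ p) ⊕ (b ∷ q) = a + b ∷ p ⊕ q

_·_ : ℝ → ℝ[T] → ℝ[T]
a · p = List.map (a *_) p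

_⊖_ : ℝ[T] → ℝ[T] → ℝ[T]
p ⊖ q = p ⊕ List.map -_ q

∑ᶠ : ∀ {n} → (Fin n → ℝ[T]) → ℝ[T]
∑ᶠ = Vector.foldr _⊕_ []

------------------------------------------------------------------------
-- Logarithm and shuffle regularisation

-- For 0 ≤ i ≤ N, the division point ε + (i/(N+1)) (1 - ε) of [ε , 1].
node : ℝ → ℕ → ℕ → ℝ
node ε N i = ε + fromℚ (+ i ℚ./ suc N) * (1ℝ - ε)

0<node : ∀ ε → 0ℝ < ε → ε < 1ℝ → ∀ N i → 0ℝ < node ε N i
0<node ε (δ , 0<δ , N₁ , h₁) (δ′ , 0<δ′ , N₂ , h₂) N i =
  δ , 0<δ , N₁ ℕ.⊔ N₂ , λ p N≤p → ℚₚ.<-≤-trans (h₁ p (ℕₚ.m⊔n≤o⇒m≤o N₁ N₂ N≤p))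
    (p≤p+q (0≤* {+ i ℚ./ suc N} {1ℚ ℚ.- seq ε p} (ℚₚ.nonNegative⁻¹ (+ i ℚ./ suc N) {{ℚₚ.normalize-nonNeg i (suc N)}})
      (≤⇒0≤- (ℚₚ.≤-trans (p≤p+q {seq ε p} (ℚₚ.<⇒≤ 0<δ′)) (ℚₚ.<⇒≤ (h₂ p (ℕₚ.m⊔n≤o⇒n≤o N₁ N₂ N≤p)))))))

-- l = -log ε = ∫_ε^1 dt/t for 0 < ε < 1, the integral being the limit of
-- the left Riemann sums over N+1 intervals of equal length.
IsNegLog : (ε : ℝ) → 0ℝ < ε → ε < 1ℝ → ℝ → Set
IsNegLog ε 0<ε ε<1 l =
  (λ N → ∑ℝ (λ i → fromℚ (unit N) * (1ℝ - ε) * recip (node ε N i) (0<node ε 0<ε ε<1 N i)) (suc N)) ⟶ l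

-- For reals s and l with s = ∑_{k>0} (1-ε)ᵏ/kᵐ and l = -log ε (each unique up
-- to _≈_):  s = c₀ + c₁ l + o(1) as ε → 0⁺
ShuffleAsymptotics : ℕ → ℝ → ℝ → Set
ShuffleAsymptotics m c₀ c₁ =
  ∀ δ → 0ℝ < δ → ∃ λ η → 0ℝ < η ×
  (∀ ε (0<ε : 0ℝ < ε) (ε<1 : ε < 1ℝ) → ε < η →
   ∀ s l → HasSum (λ k → (1ℝ - ε) ^ suc k * fromℚ (term m k)) s → IsNegLog ε 0<ε ε<1 l →
   ∣ s - (c₀ + c₁ * l) ∣ < δ)

IsShuffleRegularised : ℕ → ℝ[T] → Set
IsShuffleRegularised m z = ∃ λ c₀ → ∃ λ c₁ → ShuffleAsymptotics m c₀ c₁ × z ≋ c₀ ∷ c₁ ∷ []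

-- A product of a real and a polynomial is written with the scalar action _·_.
P : (ζˢʰ : ℕ → ℝ[T]) (m n : ℕ) → 1 ℕ.< m → 1 ℕ.< n → ℝ[T]
P ζˢʰ m n m>1 n>1 =
  ∑ᶠ {m} (λ i → let i = toℕ i in
    fromℤ (-1ℤ ℤ.^ i ℤ.* + ((n ℕ.+ i ∸ 1) C i)) · ζ (n ℕ.+ i) (ℕₚ.m≤n⇒m≤n+o i n>1) · ζˢʰ (m ∸ i))
  ⊕ fromℤ (-1ℤ ℤ.^ m) ·
  ∑ᶠ {n} (λ j → let j<n = toℕ<n j ; j = toℕ j in
    fromℤ (+ ((m ℕ.+ j ∸ 1) C j)) ·
      (ζ (m ℕ.+ j) (ℕₚ.m≤n⇒m≤n+o j m>1) · ζˢʰ (n ∸ j)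
        ⊖ const (ζ⋆ (n ∸ j) (m ℕ.+ j) (ℕₚ.m<n⇒0<n∸m j<n) (ℕₚ.m≤n⇒m≤n+o j m>1))))

{-# OPTIONS --safe #-}

-- For x, l ≥ 1 and y = x + l, expand x⁻ᵐ y⁻ⁿ in partial fractions in x (with
-- poles at x = 0 and y = 0) and sum over the box 1 ≤ x, l ≤ N.  The left side
-- tends to ζ(m,n).  The pole at x = 0 gives products of partial sums of zeta
-- values, the pole at y = 0 gives such products minus partial sums of zeta
-- star values.  All this holds up to boundary terms, which are at most H_N/N.
-- The two divergent products, which contain ζ(1), cancel each other already
-- for finite N; hence the value of the regularisation at 1 does not matter.
--
-- For j > 1 the regularisation of ζ(j) is ζ(j): by Abel's theorem
-- ζ(j) - c₀ - c₁ (-log ε) → 0 as ε → 0, and -log ε is unbounded, which is seen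
-- at ε = 2⁻ᵃ, where suitable Riemann sums of 1/t are sums of consecutive
-- reciprocals of integers.
module Submission where

open import Defs hiding (_+_; _*_; _-_; -_; _<_; ∣_∣; _^_)
import Defs as D
open import Data.Nat.Base using (ℕ) renaming (_<_ to _<ᴺ_)
open import Data.Nat.Properties using (<⇒≤)
open import Data.Fin.Base as Fin using (Fin; toℕ)
open import Data.Fin.Properties using (toℕ<n)
open import Data.Integer.Base as ℤ using (-1ℤ)
import Data.Integer.Properties as ℤₚ
open import Data.List.Base as List using ([]; _∷_)
open import Data.Nat.Base as ℕ using (zero; suc; z≤n; s≤s; _∸_)
open import Data.Nat.Combinatorics using (_C_; nCk+nC[k+1]≡[n+1]C[k+1]; nCk≡nC[n∸k]; k>n⇒nCk≡0)
import Data.Nat.Properties as ℕₚ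
open import Data.Nat.Solver renaming (module +-*-Solver to ℕ-Solver)
open import Data.Product.Base using (∃; _×_; _,_)
open import Data.Rational.Base as ℚ using (ℚ; 0ℚ; 1ℚ; ½; _+_; _*_; _-_; -_; _<_; _≤_; ∣_∣)
import Data.Rational.Properties as ℚₚ
open import Data.Rational.Solver using (module +-*-Solver)
open import Data.Rational.Unnormalised.Base using (*≡*)
import Data.Rational.Unnormalised.Properties as ℚᵘₚ
open import Data.Sum.Base using (inj₁; inj₂)
open import Function.Base using (_∘_)
open import Relation.Binary.PropositionalEquality using (_≡_; refl; sym; trans; cong; cong₂; subst; subst₂; module ≡-Reasoning)
open +-*-Solver using (solve; _:+_; _:*_; :-_; _:-_; con; _:=_)
open ℕ-Solver using () renaming (solve to solveℕ; _:+_ to _⊞_; _:*_ to _⊠_; con to conℕ; _:=_ to _⊜_)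
open ℚ^ using (_^_)
open ≡-Reasoning

-- Integers inside the rationals

-- A zeta value is given by the sequence of its partial sums, and the operations on reals and on
-- polynomials act index by index. So every coefficient of the right-hand side has an explicit
-- rational entry at index `p` (`coeff-P`). With box size `p` the claim becomes an exact rational
-- identity together with finitely many sequences to be shown null; no limits are interchanged. A
-- square box is chosen for two reasons: over it the terms with the pole at x = 0 factor, and
-- exchanging x and l preserves it, so that the terms with the pole at y = 0 are again box sums. The
-- regularised values are known only through their asymptotics, which say something about a given ε
-- only once a real l = -log ε has been exhibited. This forces a convergence proof for the Riemann
-- sums. It is carried out at rational ε, where all reals involved are given by explicit rational
-- sequences. Powers of 1/2 are convenient because Oresme's argument, by which doubling the range of
-- a harmonic sum adds at least 1/2, then bounds -log ε from below.

/1-* : ∀ a b → (a ℤ.* b) ℚ./ 1 ≡ (a ℚ./ 1) * (b ℚ./ 1)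
/1-* a b = ℚₚ.toℚᵘ-injective (ℚᵘₚ.≃-trans (toℚᵘ-/ (a ℤ.* b) 0)
  (ℚᵘₚ.≃-sym (ℚᵘₚ.≃-trans (ℚₚ.toℚᵘ-homo-* (a ℚ./ 1) (b ℚ./ 1))
    (ℚᵘₚ.*-cong (toℚᵘ-/ a 0) (toℚᵘ-/ b 0)))))

ι-+ : ∀ a b → ι (a ℕ.+ b) ≡ ι a + ι b
ι-+ zero    b = sym (ℚₚ.+-identityˡ (ι b))
ι-+ (suc a) b = begin
  ι (suc (a ℕ.+ b))    ≡⟨ ι-suc (a ℕ.+ b) ⟩
  ι (a ℕ.+ b) + 1ℚ     ≡⟨ cong (_+ 1ℚ) (ι-+ a b) ⟩
  ι a + ι b + 1ℚ       ≡⟨ solve 2 (λ a b → a :+ b :+ con 1ℚ := a :+ con 1ℚ :+ b) refl (ι a) (ι b) ⟩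
  ι a + 1ℚ + ι b       ≡⟨ cong (_+ ι b) (ι-suc a) ⟨
  ι (suc a) + ι b      ∎

ι-* : ∀ a b → ι (a ℕ.* b) ≡ ι a * ι b
ι-* a b = trans (cong (ℚ._/ 1) (ℤₚ.pos-* a b)) (/1-* (ℤ.+ a) (ℤ.+ b))

-1^ : ∀ i → (-1ℤ ℤ.^ i) ℚ./ 1 ≡ (- 1ℚ) ^ i
-1^ zero    = refl
-1^ (suc i) = trans (/1-* -1ℤ (-1ℤ ℤ.^ i)) (cong (- 1ℚ *_) (-1^ i))

-- Finite sums

∑-cong : ∀ {f g} → (∀ k → f k ≡ g k) → ∀ N → ∑ℚ f N ≡ ∑ℚ g N
∑-cong f≡g zero    = refl
∑-cong f≡g (suc N) = cong₂ _+_ (∑-cong f≡g N) (f≡g N)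

∑-0 : ∀ {f} → (∀ k → f k ≡ 0ℚ) → ∀ N → ∑ℚ f N ≡ 0ℚ
∑-0 f≡0 zero    = refl
∑-0 f≡0 (suc N) = cong₂ _+_ (∑-0 f≡0 N) (f≡0 N)

∑-+ : ∀ f g N → ∑ℚ (λ k → f k + g k) N ≡ ∑ℚ f N + ∑ℚ g N
∑-+ f g zero    = refl
∑-+ f g (suc N) = trans (cong (_+ (f N + g N)) (∑-+ f g N))
  (solve 4 (λ a b c d → a :+ b :+ (c :+ d) := a :+ c :+ (b :+ d)) refl (∑ℚ f N) (∑ℚ g N) (f N) (g N))

∑-*ˡ : ∀ c f N → ∑ℚ (λ k → c * f k) N ≡ c * ∑ℚ f N
∑-*ˡ c f zero    = sym (ℚₚ.*-zeroʳ c)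
∑-*ˡ c f (suc N) = trans (cong (λ x → x + c * f N) (∑-*ˡ c f N)) (sym (ℚₚ.*-distribˡ-+ c (∑ℚ f N) (f N)))

∑-*ʳ : ∀ c f N → ∑ℚ (λ k → f k * c) N ≡ ∑ℚ f N * c
∑-*ʳ c f N = trans (∑-cong (λ k → ℚₚ.*-comm (f k) c) N) (trans (∑-*ˡ c f N) (ℚₚ.*-comm c (∑ℚ f N)))

∑-- : ∀ f g N → ∑ℚ (λ k → f k - g k) N ≡ ∑ℚ f N - ∑ℚ g N
∑-- f g zero    = refl
∑-- f g (suc N) = trans (cong (_+ (f N - g N)) (∑-- f g N))
  (solve 4 (λ a b c d → a :- b :+ (c :- d) := a :+ c :- (b :+ d)) refl (∑ℚ f N) (∑ℚ g N) (f N) (g N))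

∑-swap : ∀ (f : ℕ → ℕ → ℚ) M N → ∑ℚ (λ i → ∑ℚ (f i) N) M ≡ ∑ℚ (λ j → ∑ℚ (λ i → f i j) M) N
∑-swap f zero    N = sym (∑-0 (λ _ → refl) N)
∑-swap f (suc M) N = trans (cong (_+ ∑ℚ (f M) N) (∑-swap f M N))
  (sym (∑-+ (λ j → ∑ℚ (λ i → f i j) M) (f M) N))

∑-head : ∀ f N → ∑ℚ f (suc N) ≡ f 0 + ∑ℚ (f ∘ suc) N
∑-head f zero    = ℚₚ.+-comm 0ℚ (f 0)
∑-head f (suc N) = trans (cong (_+ f (suc N)) (∑-head f N)) (ℚₚ.+-assoc (f 0) (∑ℚ (f ∘ suc) N) (f (suc N)))

∑-split : ∀ f d N → ∑ℚ f (d ℕ.+ N) ≡ ∑ℚ f N + ∑ℚ (λ k → f (k ℕ.+ N)) d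
∑-split f zero    N = sym (ℚₚ.+-identityʳ (∑ℚ f N))
∑-split f (suc d) N = trans (cong (_+ f (d ℕ.+ N)) (∑-split f d N))
  (ℚₚ.+-assoc (∑ℚ f N) (∑ℚ (λ k → f (k ℕ.+ N)) d) (f (d ℕ.+ N)))

∑-const : ∀ c N → ∑ℚ (λ _ → c) N ≡ ι N * c
∑-const c zero    = sym (ℚₚ.*-zeroˡ c)
∑-const c (suc N) = begin
  ∑ℚ (λ _ → c) N + c  ≡⟨ cong (_+ c) (∑-const c N) ⟩
  ι N * c + c         ≡⟨ solve 2 (λ n c → n :* c :+ c := (n :+ con 1ℚ) :* c) refl (ι N) c ⟩
  (ι N + 1ℚ) * c      ≡⟨ cong (_* c) (ι-suc N) ⟨
  ι (suc N) * c       ∎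

-- Partial fractions

-- The coefficients are kept apart from `g`, in which the sum is linear: the same expression serves
-- for powers, for box sums and for zeta values. The two sums of `P` are the cases s = -1 and, with
-- m and n exchanged, s = 1.
polarSum : (s : ℚ) (m n : ℕ) → (ℕ → ℕ → ℚ) → ℚ
polarSum s m n g = ∑ℚ (λ i → s ^ i * ι ((n ℕ.+ i ∸ 1) C i) * g (n ℕ.+ i) (m ∸ i)) m

-- The polar part at x = 0 of 1/(xᵐ yⁿ), y = x + l, in terms of w = 1/l and
-- u = 1/x, when s = -1; with s = 1 and the roles of m and n exchanged it is,
-- up to the sign (-1)ᵐ, the polar part at y = 0.
polarPart : (s : ℚ) (m n : ℕ) (w u : ℚ) → ℚ
polarPart s m n w u = polarSum s m n (λ a b → w ^ a * u ^ b)

-- Base case. The binomial `(i ∸ 1) C i` is 1 at i = 0, by truncated subtraction, and 0 for all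
-- larger i.
polarPart-zero : ∀ s m w u → polarPart s (suc m) 0 w u ≡ u ^ suc m
polarPart-zero s m w u = begin
  polarPart s (suc m) 0 w u
    ≡⟨ ∑-head (λ i → s ^ i * ι ((i ∸ 1) C i) * (w ^ i * u ^ (suc m ∸ i))) m ⟩
  1ℚ * 1ℚ * (1ℚ * u ^ suc m) + ∑ℚ (λ i → s ^ suc i * ι (i C suc i) * (w ^ suc i * u ^ (m ∸ i))) m
    ≡⟨ cong (λ x → 1ℚ * 1ℚ * (1ℚ * u ^ suc m) + x) (∑-0 vanish m) ⟩
  1ℚ * 1ℚ * (1ℚ * u ^ suc m) + 0ℚ
    ≡⟨ solve 1 (λ x → con 1ℚ :* con 1ℚ :* (con 1ℚ :* x) :+ con 0ℚ := x) refl (u ^ suc m) ⟩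
  u ^ suc m ∎
  where
  vanish : ∀ i → s ^ suc i * ι (i C suc i) * (w ^ suc i * u ^ (m ∸ i)) ≡ 0ℚ
  vanish i = begin
    s ^ suc i * ι (i C suc i) * (w ^ suc i * u ^ (m ∸ i))
      ≡⟨ cong (λ c → s ^ suc i * ι c * (w ^ suc i * u ^ (m ∸ i))) (k>n⇒nCk≡0 (ℕₚ.n<1+n i)) ⟩
    s ^ suc i * 0ℚ * (w ^ suc i * u ^ (m ∸ i))
      ≡⟨ solve 2 (λ a b → a :* con 0ℚ :* b := con 0ℚ) refl (s ^ suc i) (w ^ suc i * u ^ (m ∸ i)) ⟩
    0ℚ ∎

-- Pascal's rule. Of the two parts of C(n+i+1, i+1), the binomial C(n+i, i+1) belongs to the same
-- index with n lowered, and C(n+i, i) to the preceding index with m lowered, which costs a factor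
-- s.
polarPart-suc : ∀ s m n w u →
  polarPart s (suc m) (suc n) w u ≡ w * polarPart s (suc m) n w u + s * (w * polarPart s m (suc n) w u)
polarPart-suc s m n w u = begin
  polarPart s (suc m) (suc n) w u
    ≡⟨ ∑-head F m ⟩
  F 0 + ∑ℚ (F ∘ suc) m
    ≡⟨ cong₂ _+_ (solve 3 (λ w a b → con 1ℚ :* con 1ℚ :* (w :* a :* b) := w :* (con 1ℚ :* con 1ℚ :* (a :* b))) refl w (w ^ (n ℕ.+ 0)) (u ^ suc m))
                 (trans (∑-cong pascal m) (∑-+ (λ i → w * G (suc i)) (λ i → s * w * K i) m)) ⟩
  w * G 0 + (∑ℚ (λ i → w * G (suc i)) m + ∑ℚ (λ i → s * w * K i) m)
    ≡⟨ cong₂ (λ a b → w * G 0 + (a + b)) (∑-*ˡ w (G ∘ suc) m) (∑-*ˡ (s * w) K m) ⟩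
  w * G 0 + (w * ∑ℚ (G ∘ suc) m + s * w * ∑ℚ K m)
    ≡⟨ solve 5 (λ w g a s b → w :* g :+ (w :* a :+ s :* w :* b) := w :* (g :+ a) :+ s :* (w :* b)) refl w (G 0) (∑ℚ (G ∘ suc) m) s (∑ℚ K m) ⟩
  w * (G 0 + ∑ℚ (G ∘ suc) m) + s * (w * ∑ℚ K m)
    ≡⟨ cong (λ a → w * a + s * (w * ∑ℚ K m)) (∑-head G m) ⟨
  w * polarPart s (suc m) n w u + s * (w * polarPart s m (suc n) w u) ∎
  where
  F G K : ℕ → ℚ
  F i = s ^ i * ι ((n ℕ.+ i) C i) * (w ^ (suc n ℕ.+ i) * u ^ (suc m ∸ i))
  G i = s ^ i * ι ((n ℕ.+ i ∸ 1) C i) * (w ^ (n ℕ.+ i) * u ^ (suc m ∸ i))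
  K i = s ^ i * ι ((n ℕ.+ i) C i) * (w ^ (suc n ℕ.+ i) * u ^ (m ∸ i))
  pascal : ∀ i → F (suc i) ≡ w * G (suc i) + s * w * K i
  pascal i rewrite ℕₚ.+-suc n i = begin
    s * s ^ i * ι (suc (n ℕ.+ i) C suc i) * (w * (w * p) * q)
      ≡⟨ cong (λ c → s * s ^ i * c * (w * (w * p) * q))
           (trans (cong ι (sym (nCk+nC[k+1]≡[n+1]C[k+1] (n ℕ.+ i) i))) (ι-+ ((n ℕ.+ i) C i) ((n ℕ.+ i) C suc i))) ⟩
    s * s ^ i * (ι ((n ℕ.+ i) C i) + ι ((n ℕ.+ i) C suc i)) * (w * (w * p) * q)
      ≡⟨ solve 7 (λ s t a b w p q → s :* t :* (a :+ b) :* (w :* (w :* p) :* q)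
           := w :* (s :* t :* b :* (w :* p :* q)) :+ s :* w :* (t :* a :* (w :* p :* q))) refl
           s (s ^ i) (ι ((n ℕ.+ i) C i)) (ι ((n ℕ.+ i) C suc i)) w p q ⟩
    w * (s * s ^ i * ι ((n ℕ.+ i) C suc i) * (w * p * q)) + s * w * (s ^ i * ι ((n ℕ.+ i) C i) * (w * p * q)) ∎
    where
    p = w ^ (n ℕ.+ i)
    q = u ^ (m ∸ i)

-- Induction on m + n: `rel` turns u^(m+1) v^(n+1) into w (u^(m+1) v^n - u^m v^(n+1)), and by
-- `polarPart-suc` the polar parts obey the same recurrence. The exponents (0, 0) are excluded
-- because there the monomial is 1 while both polar parts are empty sums.
partialFractions : ∀ {u v w} → u * v ≡ w * (u - v) → ∀ m n → 0 ℕ.< m ℕ.+ n →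
  u ^ m * v ^ n ≡ polarPart (- 1ℚ) m n w u + (- 1ℚ) ^ m * polarPart 1ℚ n m w v
partialFractions {u} {v} {w} rel zero (suc n) _ = begin
  1ℚ * v ^ suc n                               ≡⟨ solve 1 (λ x → con 1ℚ :* x := con 0ℚ :+ con 1ℚ :* x) refl (v ^ suc n) ⟩
  0ℚ + 1ℚ * v ^ suc n                          ≡⟨ cong (λ x → 0ℚ + 1ℚ * x) (polarPart-zero 1ℚ n w v) ⟨
  0ℚ + 1ℚ * polarPart 1ℚ (suc n) 0 w v         ∎
partialFractions {u} {v} {w} rel (suc m) zero _ = begin
  u ^ suc m * 1ℚ                               ≡⟨ solve 2 (λ x s → x :* con 1ℚ := x :+ s :* con 0ℚ) refl (u ^ suc m) ((- 1ℚ) ^ suc m) ⟩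
  u ^ suc m + (- 1ℚ) ^ suc m * 0ℚ              ≡⟨ cong (λ x → x + (- 1ℚ) ^ suc m * 0ℚ) (polarPart-zero (- 1ℚ) m w u) ⟨
  polarPart (- 1ℚ) (suc m) 0 w u + (- 1ℚ) ^ suc m * 0ℚ ∎
partialFractions {u} {v} {w} rel (suc m) (suc n) _ = begin
  u * u ^ m * (v * v ^ n)
    ≡⟨ solve 4 (λ u v a b → u :* a :* (v :* b) := (u :* v) :* (a :* b)) refl u v (u ^ m) (v ^ n) ⟩
  u * v * (u ^ m * v ^ n)
    ≡⟨ cong (_* (u ^ m * v ^ n)) rel ⟩
  w * (u - v) * (u ^ m * v ^ n)
    ≡⟨ solve 5 (λ u v w a b → w :* (u :- v) :* (a :* b) := w :* (u :* a :* b :- a :* (v :* b))) refl u v w (u ^ m) (v ^ n) ⟩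
  w * (u ^ suc m * v ^ n - u ^ m * v ^ suc n)
    ≡⟨ cong₂ (λ x y → w * (x - y)) (partialFractions rel (suc m) n (s≤s z≤n))
         (partialFractions rel m (suc n) (subst (0 ℕ.<_) (sym (ℕₚ.+-suc m n)) (s≤s z≤n))) ⟩
  w * (a₁ + (- 1ℚ * σ) * b₁ - (a₂ + σ * b₂))
    ≡⟨ solve 6 (λ w s a b c d → w :* (a :+ (con (- 1ℚ) :* s) :* b :- (c :+ s :* d))
          := (w :* a :+ con (- 1ℚ) :* (w :* c)) :+ con (- 1ℚ) :* s :* (w :* d :+ con 1ℚ :* (w :* b))) refl w σ a₁ b₁ a₂ b₂ ⟩
  (w * a₁ + - 1ℚ * (w * a₂)) + - 1ℚ * σ * (w * b₂ + 1ℚ * (w * b₁))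
    ≡⟨ cong₂ (λ x y → x + - 1ℚ * σ * y) (polarPart-suc (- 1ℚ) m n w u) (polarPart-suc 1ℚ n m w v) ⟨
  polarPart (- 1ℚ) (suc m) (suc n) w u + - 1ℚ * σ * polarPart 1ℚ (suc n) (suc m) w v ∎
  where
  σ = (- 1ℚ) ^ m
  a₁ = polarPart (- 1ℚ) (suc m) n w u
  b₁ = polarPart 1ℚ n (suc m) w v
  a₂ = polarPart (- 1ℚ) m (suc n) w u
  b₂ = polarPart 1ℚ (suc n) m w v

-- 1/x · 1/y = 1/l · (1/x - 1/y) for y = x + l
unit-relation : ∀ x l → unit x * unit (l ℕ.+ suc x) ≡ unit l * (unit x - unit (l ℕ.+ suc x))
unit-relation x l = begin
  u * v                                        ≡⟨ solve 2 (λ u v → u :* v := con 1ℚ :* (u :* v)) refl u v ⟩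
  1ℚ * (u * v)                                 ≡⟨ cong (_* (u * v)) (unit-ι l) ⟨
  w * ι (suc l) * (u * v)                      ≡⟨ solve 5 (λ u v w a b → w :* a :* (u :* v) := w :* (u :* (v :* (a :+ b)) :- v :* (u :* b))) refl u v w (ι (suc l)) (ι (suc x)) ⟩
  w * (u * (v * (ι (suc l) + ι (suc x))) - v * (u * ι (suc x)))
    ≡⟨ cong₂ (λ a b → w * (u * a - v * b)) (trans (cong (v *_) (sym (ι-+ (suc l) (suc x)))) (unit-ι (l ℕ.+ suc x))) (unit-ι x) ⟩
  w * (u * 1ℚ - v * 1ℚ)                        ≡⟨ solve 3 (λ u v w → w :* (u :* con 1ℚ :- v :* con 1ℚ) := w :* (u :- v)) refl u v w ⟩
  w * (u - v)                                  ∎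
  where
  u = unit x
  v = unit (l ℕ.+ suc x)
  w = unit l

-- Box sums

polarSum-cong : ∀ s m n {g h} → (∀ a b → g a b ≡ h a b) → polarSum s m n g ≡ polarSum s m n h
polarSum-cong s m n g≡h = ∑-cong (λ i → cong (s ^ i * ι ((n ℕ.+ i ∸ 1) C i) *_) (g≡h (n ℕ.+ i) (m ∸ i))) m

polarSum-+ : ∀ s m n g h → polarSum s m n (λ a b → g a b + h a b) ≡ polarSum s m n g + polarSum s m n h
polarSum-+ s m n g h = trans
  (∑-cong (λ i → ℚₚ.*-distribˡ-+ (s ^ i * ι ((n ℕ.+ i ∸ 1) C i)) (g (n ℕ.+ i) (m ∸ i)) (h (n ℕ.+ i) (m ∸ i))) m)
  (∑-+ (λ i → s ^ i * ι ((n ℕ.+ i ∸ 1) C i) * g (n ℕ.+ i) (m ∸ i)) (λ i → s ^ i * ι ((n ℕ.+ i ∸ 1) C i) * h (n ℕ.+ i) (m ∸ i)) m)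

polarSum-neg : ∀ s m n g → polarSum s m n (λ a b → - g a b) ≡ - polarSum s m n g
polarSum-neg s m n g = begin
  polarSum s m n (λ a b → - g a b)
    ≡⟨ ∑-cong (λ i → solve 2 (λ c x → c :* (:- x) := con (- 1ℚ) :* (c :* x)) refl (s ^ i * ι ((n ℕ.+ i ∸ 1) C i)) (g (n ℕ.+ i) (m ∸ i))) m ⟩
  ∑ℚ (λ i → - 1ℚ * (s ^ i * ι ((n ℕ.+ i ∸ 1) C i) * g (n ℕ.+ i) (m ∸ i))) m
    ≡⟨ ∑-*ˡ (- 1ℚ) (λ i → s ^ i * ι ((n ℕ.+ i ∸ 1) C i) * g (n ℕ.+ i) (m ∸ i)) m ⟩
  - 1ℚ * polarSum s m n g
    ≡⟨ solve 1 (λ x → con (- 1ℚ) :* x := :- x) refl (polarSum s m n g) ⟩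
  - polarSum s m n g ∎

polarSum-∑ : ∀ s m n (g : ℕ → ℕ → ℕ → ℚ) N →
  ∑ℚ (λ x → polarSum s m n (g x)) N ≡ polarSum s m n (λ a b → ∑ℚ (λ x → g x a b) N)
polarSum-∑ s m n g N = trans
  (∑-swap (λ x i → s ^ i * ι ((n ℕ.+ i ∸ 1) C i) * g x (n ℕ.+ i) (m ∸ i)) N m)
  (∑-cong (λ i → ∑-*ˡ (s ^ i * ι ((n ℕ.+ i ∸ 1) C i)) (λ x → g x (n ℕ.+ i) (m ∸ i)) N) m)

-- ∑ x⁻ᵃ (x + l)⁻ᵇ over 1 ≤ x, l ≤ N
boxSum : (N a b : ℕ) → ℚ
boxSum N a b = ∑ℚ (λ x → term a x * ∑ℚ (λ l → term b (l ℕ.+ suc x)) N) N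

-- The part of boxSum N a b with x + l > N
overflow : (N a b : ℕ) → ℚ
overflow N a b = ∑ℚ (λ x → term a x * ∑ℚ (λ l → term b (l ℕ.+ N)) (suc x)) N

Z : (a N : ℕ) → ℚ
Z a = ∑ℚ (term a)

Z₂ Z⋆ : (a b N : ℕ) → ℚ
Z₂ a b = ∑ℚ (λ k → Z a k * term b k)
Z⋆ a b = ∑ℚ (λ k → Z a (suc k) * term b k)

-- The pairs in the square split into those with k₁ < k₂ and those with k₂ ≤ k₁; the diagonal goes
-- to the star sum.
stuffle : ∀ a b N → Z a N * Z b N ≡ Z₂ a b N + Z⋆ b a N
stuffle a b zero    = refl
stuffle a b (suc N) = begin
  (Z a N + term a N) * (Z b N + term b N)
    ≡⟨ solve 4 (λ x t y u → (x :+ t) :* (y :+ u) := x :* y :+ (x :* u :+ (y :+ u) :* t)) refl (Z a N) (term a N) (Z b N) (term b N) ⟩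
  Z a N * Z b N + (Z a N * term b N + (Z b N + term b N) * term a N)
    ≡⟨ cong (_+ (Z a N * term b N + (Z b N + term b N) * term a N)) (stuffle a b N) ⟩
  Z₂ a b N + Z⋆ b a N + (Z a N * term b N + (Z b N + term b N) * term a N)
    ≡⟨ solve 4 (λ p q r s → p :+ q :+ (r :+ s) := (p :+ r) :+ (q :+ s)) refl (Z₂ a b N) (Z⋆ b a N) (Z a N * term b N) ((Z b N + term b N) * term a N) ⟩
  Z₂ a b (suc N) + Z⋆ b a (suc N) ∎

-- For fixed x, adjoining 1 ≤ y ≤ x to the range x < y ≤ x + N gives 1 ≤ y ≤ x + N, which is then
-- cut at N instead of x. Summed against x⁻ᵃ, the adjoined terms form the star sum and those beyond
-- N the overflow.
boxSum≡ : ∀ a b N → boxSum N a b ≡ overflow N a b + (Z a N * Z b N - Z⋆ b a N)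
boxSum≡ a b N = begin
  boxSum N a b
    ≡⟨ ∑-cong pointwise N ⟩
  ∑ℚ (λ x → term a x * o x + (term a x * Z b N - Z b (suc x) * term a x)) N
    ≡⟨ ∑-+ (λ x → term a x * o x) (λ x → term a x * Z b N - Z b (suc x) * term a x) N ⟩
  overflow N a b + ∑ℚ (λ x → term a x * Z b N - Z b (suc x) * term a x) N
    ≡⟨ cong (overflow N a b +_) (trans (∑-- (λ x → term a x * Z b N) (λ x → Z b (suc x) * term a x) N)
         (cong (_- Z⋆ b a N) (∑-*ʳ (Z b N) (term a) N))) ⟩
  overflow N a b + (Z a N * Z b N - Z⋆ b a N) ∎
  where
  o : ℕ → ℚ
  o x = ∑ℚ (λ l → term b (l ℕ.+ N)) (suc x)
  pointwise : ∀ x → term a x * ∑ℚ (λ l → term b (l ℕ.+ suc x)) N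
                  ≡ term a x * o x + (term a x * Z b N - Z b (suc x) * term a x)
  pointwise x = begin
    t * i                         ≡⟨ solve 3 (λ t i z → t :* i := t :* (z :+ i) :- z :* t) refl t i (Z b (suc x)) ⟩
    t * (Z b (suc x) + i) - Z b (suc x) * t
      ≡⟨ cong (λ y → t * y - Z b (suc x) * t)
           (trans (sym (∑-split (term b) N (suc x))) (trans (cong (Z b) (ℕₚ.+-comm N (suc x))) (∑-split (term b) (suc x) N))) ⟩
    t * (Z b N + o x) - Z b (suc x) * t
      ≡⟨ solve 4 (λ t z o y → t :* (z :+ o) :- y :* t := t :* o :+ (t :* z :- y :* t)) refl t (Z b N) (o x) (Z b (suc x)) ⟩
    t * o x + (t * Z b N - Z b (suc x) * t) ∎
    where
    t = term a x
    i = ∑ℚ (λ l → term b (l ℕ.+ suc x)) N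

boxSum-partialFractions : ∀ m n N → 0 ℕ.< m ℕ.+ n →
  boxSum N m n ≡ polarSum (- 1ℚ) m n (λ a b → Z a N * Z b N) + (- 1ℚ) ^ m * polarSum 1ℚ n m (boxSum N)
boxSum-partialFractions m n N 0<m+n = begin
  boxSum N m n
    ≡⟨ ∑-cong (λ x → sym (∑-*ˡ (term m x) (λ l → term n (l ℕ.+ suc x)) N)) N ⟩
  ∑ℚ (λ x → ∑ℚ (λ l → term m x * term n (l ℕ.+ suc x)) N) N
    ≡⟨ ∑-cong (λ x → ∑-cong (λ l → partialFractions (unit-relation x l) m n 0<m+n) N) N ⟩
  ∑ℚ (λ x → ∑ℚ (λ l → polarSum (- 1ℚ) m n (f x l) + σ * polarSum 1ℚ n m (g x l)) N) N
    ≡⟨ ∑-cong (λ x → trans (∑-+ (λ l → polarSum (- 1ℚ) m n (f x l)) (λ l → σ * polarSum 1ℚ n m (g x l)) N)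
         (cong₂ _+_ (polarSum-∑ (- 1ℚ) m n (f x) N)
           (trans (∑-*ˡ σ (λ l → polarSum 1ℚ n m (g x l)) N) (cong (σ *_) (polarSum-∑ 1ℚ n m (g x) N))))) N ⟩
  ∑ℚ (λ x → polarSum (- 1ℚ) m n (f′ x) + σ * polarSum 1ℚ n m (g′ x)) N
    ≡⟨ trans (∑-+ (λ x → polarSum (- 1ℚ) m n (f′ x)) (λ x → σ * polarSum 1ℚ n m (g′ x)) N)
         (cong₂ _+_ (polarSum-∑ (- 1ℚ) m n f′ N)
           (trans (∑-*ˡ σ (λ x → polarSum 1ℚ n m (g′ x)) N) (cong (σ *_) (polarSum-∑ 1ℚ n m g′ N)))) ⟩
  polarSum (- 1ℚ) m n (λ a b → ∑ℚ (λ x → f′ x a b) N) + σ * polarSum 1ℚ n m (λ a b → ∑ℚ (λ x → g′ x a b) N)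
    ≡⟨ cong₂ (λ x y → x + σ * y) (polarSum-cong (- 1ℚ) m n product) (polarSum-cong 1ℚ n m box) ⟩
  polarSum (- 1ℚ) m n (λ a b → Z a N * Z b N) + σ * polarSum 1ℚ n m (boxSum N) ∎
  where
  σ = (- 1ℚ) ^ m
  f g : ℕ → ℕ → ℕ → ℕ → ℚ
  f x l a b = term a l * term b x
  g x l a b = term a l * term b (l ℕ.+ suc x)
  f′ g′ : ℕ → ℕ → ℕ → ℚ
  f′ x a b = ∑ℚ (λ l → f x l a b) N
  g′ x a b = ∑ℚ (λ l → g x l a b) N
  product : ∀ a b → ∑ℚ (λ x → f′ x a b) N ≡ Z a N * Z b N
  product a b = trans (∑-cong (λ x → ∑-*ʳ (term b x) (term a) N) N) (∑-*ˡ (Z a N) (term b) N)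
  -- Here l carries the exponent a, so the roles of x and l have to be exchanged; y = x + l is
  -- symmetric in them.
  box : ∀ a b → ∑ℚ (λ x → g′ x a b) N ≡ boxSum N a b
  box a b = trans (∑-swap (λ x l → g x l a b) N N)
    (∑-cong (λ l → trans (∑-*ˡ (term a l) (λ x → term b (l ℕ.+ suc x)) N)
      (cong (term a l *_) (∑-cong (λ x → cong (term b) (l+1+x≡x+1+l l x)) N))) N)
    where
    l+1+x≡x+1+l : ∀ l x → l ℕ.+ suc x ≡ x ℕ.+ suc l
    l+1+x≡x+1+l l x = trans (ℕₚ.+-suc l x) (trans (cong suc (ℕₚ.+-comm l x)) (sym (ℕₚ.+-suc x l)))

-- The box sum is evaluated twice: directly, where `stuffle` leaves only the sum over x < y, and
-- through its partial fractions. Being exact for each N, the identity can contain the divergent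
-- `Z 1 N`.
truncatedIdentity : ∀ m n N → 0 ℕ.< m ℕ.+ n →
  Z₂ m n N + overflow N m n ≡
  polarSum (- 1ℚ) m n (λ a b → Z a N * Z b N)
  + (- 1ℚ) ^ m * polarSum 1ℚ n m (λ a b → overflow N a b + (Z a N * Z b N - Z⋆ b a N))
truncatedIdentity m n N 0<m+n = begin
  Z₂ m n N + overflow N m n
    ≡⟨ solve 3 (λ s o t → s :+ o := o :+ (s :+ t :- t)) refl (Z₂ m n N) (overflow N m n) (Z⋆ n m N) ⟩
  overflow N m n + (Z₂ m n N + Z⋆ n m N - Z⋆ n m N)
    ≡⟨ cong (λ x → overflow N m n + (x - Z⋆ n m N)) (stuffle m n N) ⟨
  overflow N m n + (Z m N * Z n N - Z⋆ n m N)
    ≡⟨ boxSum≡ m n N ⟨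
  boxSum N m n
    ≡⟨ boxSum-partialFractions m n N 0<m+n ⟩
  polarSum (- 1ℚ) m n (λ a b → Z a N * Z b N) + (- 1ℚ) ^ m * polarSum 1ℚ n m (boxSum N)
    ≡⟨ cong (λ x → polarSum (- 1ℚ) m n (λ a b → Z a N * Z b N) + (- 1ℚ) ^ m * x) (polarSum-cong 1ℚ n m (λ a b → boxSum≡ a b N)) ⟩
  polarSum (- 1ℚ) m n (λ a b → Z a N * Z b N) + (- 1ℚ) ^ m * polarSum 1ℚ n m (λ a b → overflow N a b + (Z a N * Z b N - Z⋆ b a N)) ∎

-- Null sequences

Bounded : (ℕ → ℚ) → Set
Bounded b = ∃ λ B → 0ℚ < B × Eventually λ p → ∣ b p ∣ ≤ B

bounded-const : ∀ c → Bounded (λ _ → c)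
bounded-const c = ∣ c ∣ + 1ℚ , ℚₚ.+-mono-≤-< (ℚₚ.0≤∣p∣ c) 0<1 , 0 , λ _ _ → p≤p+q 0≤1

null-cong : ∀ {a b} → (∀ p → a p ≡ b p) → IsNull a → IsNull b
null-cong a≡b nullᵃ ε 0<ε with nullᵃ ε 0<ε
... | N , h = N , λ p N≤p → subst (λ t → ∣ t ∣ < ε) (a≡b p) (h p N≤p)

null-≤ : ∀ {a b : ℕ → ℚ} → (∀ p → ∣ a p ∣ ≤ b p) → (∀ ε → 0ℚ < ε → Eventually λ p → b p < ε) → IsNull a
null-≤ a≤b nullᵇ ε 0<ε with nullᵇ ε 0<ε
... | N , h = N , λ p N≤p → ℚₚ.≤-<-trans (a≤b p) (h p N≤p)

null-+ : ∀ {a b} → IsNull a → IsNull b → IsNull (λ p → a p + b p)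
null-+ {a} {b} nullᵃ nullᵇ ε 0<ε with nullᵃ (½ * ε) (0<½* 0<ε) | nullᵇ (½ * ε) (0<½* 0<ε)
... | N₁ , h₁ | N₂ , h₂ = N₁ ℕ.⊔ N₂ , λ p N≤p →
  ℚₚ.≤-<-trans (ℚₚ.∣p+q∣≤∣p∣+∣q∣ (a p) (b p))
    (subst (∣ a p ∣ + ∣ b p ∣ <_) (½+½ ε)
      (ℚₚ.+-mono-< (h₁ p (ℕₚ.m⊔n≤o⇒m≤o N₁ N₂ N≤p)) (h₂ p (ℕₚ.m⊔n≤o⇒n≤o N₁ N₂ N≤p))))

null-neg : ∀ {a} → IsNull a → IsNull (λ p → - a p)
null-neg {a} nullᵃ ε 0<ε with nullᵃ ε 0<ε
... | N , h = N , λ p N≤p → subst (_< ε) (sym (ℚₚ.∣-p∣≡∣p∣ (a p))) (h p N≤p)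

null-* : ∀ {a b} → Bounded b → IsNull a → IsNull (λ p → b p * a p)
null-* {a} {b} (B , 0<B , N₁ , h₁) nullᵃ ε 0<ε =
  let γ , 0<γ , Bγ≡ε = shrink 0<ε 0<B
      N₂ , h₂ = nullᵃ γ 0<γ
  in N₁ ℕ.⊔ N₂ , λ p N≤p →
    subst₂ _<_ (sym (ℚₚ.∣p*q∣≡∣p∣*∣q∣ (b p) (a p))) Bγ≡ε
      (ℚₚ.≤-<-trans
        (ℚₚ.*-monoʳ-≤-nonNeg ∣ a p ∣ {{ℚₚ.∣-∣-nonNeg (a p)}} (h₁ p (ℕₚ.m⊔n≤o⇒m≤o N₁ N₂ N≤p)))
        (ℚₚ.*-monoʳ-<-pos B {{ℚ.positive 0<B}} (h₂ p (ℕₚ.m⊔n≤o⇒n≤o N₁ N₂ N≤p))))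

null-0 : IsNull (λ _ → 0ℚ)
null-0 ε 0<ε = 0 , λ _ _ → 0<ε

null-∑ : ∀ (f : ℕ → ℕ → ℚ) M → (∀ i → i ℕ.< M → IsNull (f i)) → IsNull (λ p → ∑ℚ (λ i → f i p) M)
null-∑ f zero    _     = null-0
null-∑ f (suc M) nullᶠ = null-+ (null-∑ f M (λ i i<M → nullᶠ i (ℕₚ.m<n⇒m<1+n i<M))) (nullᶠ M (ℕₚ.n<1+n M))

Z-bounded : ∀ a → 1 ℕ.< a → Bounded (Z a)
Z-bounded a a>1 = eventuallyBounded (ζ a a>1)

-- With x counted from 1, the inner sum has x terms, each at most 1/(N+1), and x⁻ᵃ is at most x⁻².
-- What remains is x⁻¹/(N+1). The exponent b = 1 is covered, as it occurs at the last j.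
overflow≤ : ∀ a b N → 1 ℕ.< a → 0 ℕ.< b → overflow N a b ≤ H N * unit N
overflow≤ a b N a>1 b>0 = subst (overflow N a b ≤_) (∑-*ʳ (unit N) unit N) (∑ℚ-mono bound N)
  where
  bound : ∀ x → term a x * ∑ℚ (λ l → term b (l ℕ.+ N)) (suc x) ≤ unit x * unit N
  bound x = subst (term a x * ∑ℚ (λ l → term b (l ℕ.+ N)) (suc x) ≤_) eq
    (*-mono-≤ (∑ℚ-nonNeg (λ l → 0≤term b (l ℕ.+ N)) (suc x)) (0≤* (0≤unit x) (0≤unit x)) (term≤unit² a x a>1) inner)
    where
    inner : ∑ℚ (λ l → term b (l ℕ.+ N)) (suc x) ≤ ι (suc x) * unit N
    inner = subst (∑ℚ (λ l → term b (l ℕ.+ N)) (suc x) ≤_) (∑-const (unit N) (suc x))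
      (∑ℚ-mono (λ l → ℚₚ.≤-trans (term≤unit b (l ℕ.+ N) b>0) (unit-antimono (ℕₚ.m≤n+m N l))) (suc x))
    eq : unit x * unit x * (ι (suc x) * unit N) ≡ unit x * unit N
    eq = begin
      unit x * unit x * (ι (suc x) * unit N)   ≡⟨ solve 3 (λ u i n → u :* u :* (i :* n) := u :* i :* (u :* n)) refl (unit x) (ι (suc x)) (unit N) ⟩
      unit x * ι (suc x) * (unit x * unit N)   ≡⟨ cong (_* (unit x * unit N)) (unit-ι x) ⟩
      1ℚ * (unit x * unit N)                   ≡⟨ ℚₚ.*-identityˡ (unit x * unit N) ⟩
      unit x * unit N                          ∎

H*unit≤majorant : ∀ N → H N * unit N ≤ majorant N
H*unit≤majorant N = subst (H N * unit N ≤_)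
  (solve 2 (λ h u → h :* u :+ (h :* u :+ con (2ℚ + 2ℚ) :* u) := con 2ℚ :* ((h :+ con 2ℚ) :* u)) refl (H N) (unit N))
  (p≤p+q (0≤+ (0≤* (0≤H N) (0≤unit N)) (0≤* {2ℚ + 2ℚ} (0≤+ (0≤+ 0≤1 0≤1) (0≤+ 0≤1 0≤1)) (0≤unit N))))

overflow-null : ∀ a b → 1 ℕ.< a → 0 ℕ.< b → IsNull (λ N → overflow N a b)
overflow-null a b a>1 b>0 = null-≤ {b = majorant} (λ N → subst (_≤ majorant N) (sym (ℚₚ.0≤p⇒∣p∣≡p (0≤overflow N)))
  (ℚₚ.≤-trans (overflow≤ a b N a>1 b>0) (H*unit≤majorant N))) majorant-null
  where
  0≤overflow : ∀ N → 0ℚ ≤ overflow N a b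
  0≤overflow N = ∑ℚ-nonNeg (λ x → 0≤* (0≤term a x) (∑ℚ-nonNeg (λ l → 0≤term b (l ℕ.+ N)) (suc x))) N

polarSum-null : ∀ s m n (g : ℕ → ℕ → ℕ → ℚ) → (∀ i → i ℕ.< m → IsNull (λ p → g p (n ℕ.+ i) (m ∸ i))) →
  IsNull (λ p → polarSum s m n (g p))
polarSum-null s m n g nullᵍ = null-∑ (λ i p → s ^ i * ι ((n ℕ.+ i ∸ 1) C i) * g p (n ℕ.+ i) (m ∸ i)) m
  (λ i i<m → null-* (bounded-const (s ^ i * ι ((n ℕ.+ i ∸ 1) C i))) (nullᵍ i i<m))

-- The products in `P`, with the regularised factor at b replaced by a sequence `D b`. It is linear
-- in `D`, which will be the coefficients of `ζˢʰ`, the partial sums `Z`, or their difference.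
zetaPart : (m n : ℕ) → (ℕ → ℕ → ℚ) → ℕ → ℚ
zetaPart m n D p = polarSum (- 1ℚ) m n (λ a b → Z a p * D b p) + (- 1ℚ) ^ m * polarSum 1ℚ n m (λ a b → Z a p * D b p)

1^ : ∀ n → 1ℚ ^ n ≡ 1ℚ
1^ zero    = refl
1^ (suc n) = trans (ℚₚ.*-identityˡ (1ℚ ^ n)) (1^ n)

C-sym : ∀ a b → (a ℕ.+ b) C b ≡ (b ℕ.+ a) C a
C-sym a b = trans (nCk≡nC[n∸k] (ℕₚ.m≤n+m b a)) (cong₂ _C_ (ℕₚ.+-comm a b) (ℕₚ.m+n∸n≡m a b))

-- The two terms in which D 1 occurs cancel.
zetaPart-null : ∀ m n → 1 ℕ.< m → 1 ℕ.< n → (D : ℕ → ℕ → ℚ) → (∀ b → 1 ℕ.< b → IsNull (D b)) →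
  IsNull (zetaPart m n D)
zetaPart-null m@(suc m′) n@(suc n′) m>1 n>1 D nullᴰ =
  null-cong regroup (null-+ (null-∑ X m′ X-null) (null-* (bounded-const ((- 1ℚ) ^ m)) (null-∑ Y n′ Y-null)))
  where
  X Y : ℕ → ℕ → ℚ
  X i p = (- 1ℚ) ^ i * ι ((n ℕ.+ i ∸ 1) C i) * (Z (n ℕ.+ i) p * D (m ∸ i) p)
  Y j p = 1ℚ ^ j * ι ((m ℕ.+ j ∸ 1) C j) * (Z (m ℕ.+ j) p * D (n ∸ j) p)
  2≤ : ∀ i k → i ℕ.< k → 1 ℕ.< suc k ∸ i
  2≤ i k i<k = subst (1 ℕ.<_) (sym (ℕₚ.+-∸-assoc 1 (ℕₚ.<⇒≤ i<k))) (s≤s (ℕₚ.m<n⇒0<n∸m i<k))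
  X-null : ∀ i → i ℕ.< m′ → IsNull (X i)
  X-null i i<m′ = null-* (bounded-const ((- 1ℚ) ^ i * ι ((n ℕ.+ i ∸ 1) C i)))
    (null-* (Z-bounded (n ℕ.+ i) (ℕₚ.m≤n⇒m≤n+o i n>1)) (nullᴰ (m ∸ i) (2≤ i m′ i<m′)))
  Y-null : ∀ j → j ℕ.< n′ → IsNull (Y j)
  Y-null j j<n′ = null-* (bounded-const (1ℚ ^ j * ι ((m ℕ.+ j ∸ 1) C j)))
    (null-* (Z-bounded (m ℕ.+ j) (ℕₚ.m≤n⇒m≤n+o j m>1)) (nullᴰ (n ∸ j) (2≤ j n′ j<n′)))
  -- Up to sign, the term j = n - 1 is the term i = m - 1: both are C(m+n-2, m-1) Z(m+n-1) D(1).
  -- Their signs are (-1)^m and (-1)^(m-1).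
  last : ∀ p → Y n′ p ≡ ι ((n′ ℕ.+ m′) C m′) * (Z (n ℕ.+ m′) p * D (m ∸ m′) p)
  last p = cong₂ _*_
    (trans (cong₂ _*_ (1^ n′) (cong ι (C-sym m′ n′))) (ℚₚ.*-identityˡ (ι ((n′ ℕ.+ m′) C m′))))
    (cong₂ (λ a b → Z (suc a) p * D b p) (ℕₚ.+-comm m′ n′) (trans (ℕₚ.m+n∸n≡m 1 n′) (sym (ℕₚ.m+n∸n≡m 1 m′))))
  regroup : ∀ p → ∑ℚ (λ i → X i p) m′ + (- 1ℚ) ^ m * ∑ℚ (λ j → Y j p) n′ ≡ zetaPart m n D p
  regroup p = begin
    x + - 1ℚ * σ * y
      ≡⟨ solve 5 (λ x s y c z → x :+ con (- 1ℚ) :* s :* y := x :+ s :* c :* z :+ con (- 1ℚ) :* s :* (y :+ c :* z)) refl x σ y c z ⟩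
    x + σ * c * z + - 1ℚ * σ * (y + c * z)
      ≡⟨ cong (λ t → x + σ * c * z + - 1ℚ * σ * (y + t)) (last p) ⟨
    zetaPart m n D p ∎
    where
    x = ∑ℚ (λ i → X i p) m′
    y = ∑ℚ (λ j → Y j p) n′
    σ = (- 1ℚ) ^ m′
    c = ι ((n′ ℕ.+ m′) C m′)
    z = Z (n ℕ.+ m′) p * D (m ∸ m′) p

-- Riemann sums

-- As `unit` is shifted by one, the index belonging to the product (N+1)(M+1) is `M + N * suc M`,
-- its predecessor.
unit-* : ∀ N M → unit (M ℕ.+ N ℕ.* suc M) ≡ unit N * unit M
unit-* N M = begin
  q                                                 ≡⟨ solve 1 (λ q → q := q :* con 1ℚ :* con 1ℚ) refl q ⟩
  q * 1ℚ * 1ℚ                                       ≡⟨ cong₂ (λ a b → q * a * b) (unit-ι N) (unit-ι M) ⟨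
  q * (unit N * ι (suc N)) * (unit M * ι (suc M))   ≡⟨ solve 5 (λ q a b c d → q :* (a :* b) :* (c :* d) := q :* (b :* d) :* (a :* c)) refl q (unit N) (ι (suc N)) (unit M) (ι (suc M)) ⟩
  q * (ι (suc N) * ι (suc M)) * (unit N * unit M)   ≡⟨ cong (λ a → q * a * (unit N * unit M)) (ι-* (suc N) (suc M)) ⟨
  q * ι (suc N ℕ.* suc M) * (unit N * unit M)       ≡⟨ cong (_* (unit N * unit M)) (unit-ι (M ℕ.+ N ℕ.* suc M)) ⟩
  1ℚ * (unit N * unit M)                            ≡⟨ ℚₚ.*-identityˡ (unit N * unit M) ⟩
  unit N * unit M                                   ∎
  where
  q = unit (M ℕ.+ N ℕ.* suc M)

/-unit : ∀ i N → (ℤ.+ i) ℚ./ suc N ≡ ι i * unit N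
/-unit i N = ℚₚ.toℚᵘ-injective (ℚᵘₚ.≃-trans (toℚᵘ-/ (ℤ.+ i) N)
  (ℚᵘₚ.≃-sym (ℚᵘₚ.≃-trans (ℚₚ.toℚᵘ-homo-* (ι i) (unit N))
    (ℚᵘₚ.≃-trans (ℚᵘₚ.*-cong (toℚᵘ-/ (ℤ.+ i) 0) (toℚᵘ-/ (ℤ.+ 1) N)) (*≡* eq)))))
  where
  eq : ((ℤ.+ i) ℤ.* (ℤ.+ 1)) ℤ.* (ℤ.+ suc N) ≡ (ℤ.+ i) ℤ.* ((ℤ.+ 1) ℤ.* (ℤ.+ suc N))
  eq = ℤₚ.*-assoc (ℤ.+ i) (ℤ.+ 1) (ℤ.+ suc N)

∑-blocks : ∀ g N M → ∑ℚ g (N ℕ.* M) ≡ ∑ℚ (λ i → ∑ℚ (λ r → g (r ℕ.+ i ℕ.* M)) M) N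
∑-blocks g zero    M = refl
∑-blocks g (suc N) M = trans (∑-split g M (N ℕ.* M))
  (cong (_+ ∑ℚ (λ r → g (r ℕ.+ N ℕ.* M)) M) (∑-blocks g N M))

∑-mono-< : ∀ {f g} N → (∀ k → k ℕ.< N → f k ≤ g k) → ∑ℚ f N ≤ ∑ℚ g N
∑-mono-< zero    _   = ℚₚ.≤-refl
∑-mono-< (suc N) f≤g = ℚₚ.+-mono-≤ (∑-mono-< N (λ k k<N → f≤g k (ℕₚ.m<n⇒m<1+n k<N))) (f≤g N (ℕₚ.n<1+n N))

*-monoˡ : ∀ {r p q} → 0ℚ ≤ r → p ≤ q → r * p ≤ r * q
*-monoˡ {r} 0≤r = ℚₚ.*-monoˡ-≤-nonNeg r {{ℚ.nonNegative 0≤r}}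

ι-mono : ∀ {i j} → i ℕ.≤ j → ι i ≤ ι j
ι-mono {i} {j} i≤j = subst (ι i ≤_) (trans (sym (ι-+ i (j ∸ i))) (cong ι (ℕₚ.m+[n∸m]≡n i≤j))) (p≤p+q (0≤ι (j ∸ i)))

module RiemannSums (φ : ℚ → ℚ) (0<φ : ∀ {t} → 0ℚ ≤ t → 0ℚ < φ t)
                   (φ-antitone : ∀ {s t} → 0ℚ ≤ s → s ≤ t → φ t ≤ φ s) where

  leftSum : ℕ → ℚ
  leftSum N = unit N * ∑ℚ (λ i → φ (ι i * unit N)) (suc N)

  refinement : ∀ N M → leftSum (M ℕ.+ N ℕ.* suc M)
    ≡ unit N * (unit M * ∑ℚ (λ i → ∑ℚ (λ r → φ ((ι r * unit M + ι i) * unit N)) (suc M)) (suc N))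
  refinement N M = begin
    unit Q * ∑ℚ (λ k → φ (ι k * unit Q)) (suc N ℕ.* suc M)
      ≡⟨ cong₂ _*_ (unit-* N M) (trans (∑-blocks (λ k → φ (ι k * unit Q)) (suc N) (suc M))
           (∑-cong (λ i → ∑-cong (λ r → cong φ (point i r)) (suc M)) (suc N))) ⟩
    unit N * unit M * S
      ≡⟨ ℚₚ.*-assoc (unit N) (unit M) S ⟩
    unit N * (unit M * S) ∎
    where
    Q = M ℕ.+ N ℕ.* suc M
    S = ∑ℚ (λ i → ∑ℚ (λ r → φ ((ι r * unit M + ι i) * unit N)) (suc M)) (suc N)
    point : ∀ i r → ι (r ℕ.+ i ℕ.* suc M) * unit Q ≡ (ι r * unit M + ι i) * unit N
    point i r = begin
      ι (r ℕ.+ i ℕ.* suc M) * unit Q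
        ≡⟨ cong₂ _*_ (trans (ι-+ r (i ℕ.* suc M)) (cong (ι r +_) (ι-* i (suc M)))) (unit-* N M) ⟩
      (ι r + ι i * ι (suc M)) * (unit N * unit M)
        ≡⟨ solve 5 (λ r i m a b → (r :+ i :* m) :* (a :* b) := (r :* b :+ i :* (b :* m)) :* a) refl (ι r) (ι i) (ι (suc M)) (unit N) (unit M) ⟩
      (ι r * unit M + ι i * (unit M * ι (suc M))) * unit N
        ≡⟨ cong (λ a → (ι r * unit M + a) * unit N) (trans (cong (ι i *_) (unit-ι M)) (ℚₚ.*-identityʳ (ι i))) ⟩
      (ι r * unit M + ι i) * unit N ∎

  average : ∀ M c → unit M * ∑ℚ (λ _ → c) (suc M) ≡ c
  average M c = begin
    unit M * ∑ℚ (λ _ → c) (suc M)  ≡⟨ cong (unit M *_) (∑-const c (suc M)) ⟩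
    unit M * (ι (suc M) * c)       ≡⟨ ℚₚ.*-assoc (unit M) (ι (suc M)) c ⟨
    unit M * ι (suc M) * c         ≡⟨ cong (_* c) (unit-ι M) ⟩
    1ℚ * c                         ≡⟨ ℚₚ.*-identityˡ c ⟩
    c                              ∎

  0≤grid : ∀ i N → 0ℚ ≤ ι i * unit N
  0≤grid i N = 0≤* (0≤ι i) (0≤unit N)

  -- On each coarse interval the refined sum averages values of `φ` at or to the right of the left
  -- end, where the antitone `φ` is largest.
  refine-≤ : ∀ N M → leftSum (M ℕ.+ N ℕ.* suc M) ≤ leftSum N
  refine-≤ N M = subst (_≤ leftSum N) (sym (refinement N M)) (*-monoˡ (0≤unit N)
    (subst (_≤ ∑ℚ (λ i → φ (ι i * unit N)) (suc N)) (∑-*ˡ (unit M) (λ i → ∑ℚ (λ r → φ ((ι r * unit M + ι i) * unit N)) (suc M)) (suc N))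
      (∑ℚ-mono (λ i → subst (unit M * ∑ℚ (λ r → φ ((ι r * unit M + ι i) * unit N)) (suc M) ≤_) (average M (φ (ι i * unit N)))
        (*-monoˡ (0≤unit M) (∑ℚ-mono (λ r → φ-antitone (0≤grid i N) (step i r)) (suc M)))) (suc N))))
    where
    step : ∀ i r → ι i * unit N ≤ (ι r * unit M + ι i) * unit N
    step i r = ℚₚ.*-monoʳ-≤-nonNeg (unit N) {{ℚ.nonNegative (0≤unit N)}}
      (subst (ι i ≤_) (ℚₚ.+-comm (ι i) (ι r * unit M)) (p≤p+q (0≤grid r M)))

  -- The average over a coarse interval is at least the value at its right end. Right ends are left
  -- ends shifted by one, so only the value at 0, with weight 1/(N+1), is lost.
  ≤-refine : ∀ N M → leftSum N ≤ φ 0ℚ * unit N + leftSum (M ℕ.+ N ℕ.* suc M)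
  ≤-refine N M = subst₂ _≤_ (cong (unit N *_) (sym (∑-head f N)))
    (trans (solve 3 (λ u a s → u :* (a :+ s) := a :* u :+ u :* s) refl (unit N) (f 0) (unit M * S))
      (cong₂ (λ a b → φ a * unit N + b) (ℚₚ.*-zeroˡ (unit N)) (sym (refinement N M))))
    (*-monoˡ (0≤unit N) (ℚₚ.+-monoʳ-≤ (f 0)
      -- Adding the positive value at t = 1 supplies a right end for the last interval.
      (ℚₚ.≤-trans (p≤p+q (ℚₚ.<⇒≤ (0<φ (0≤grid (suc N) N))))
        (subst (∑ℚ (λ i → f (suc i)) (suc N) ≤_) (∑-*ˡ (unit M) block (suc N))
          (∑ℚ-mono (λ i → subst (_≤ unit M * block i) (average M (f (suc i)))
            (*-monoˡ (0≤unit M) (∑-mono-< (suc M) (λ r r≤M → φ-antitone (0≤* (0≤+ (0≤grid r M) (0≤ι i)) (0≤unit N)) (step i r r≤M))))) (suc N))))))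
    where
    f block : ℕ → ℚ
    f i = φ (ι i * unit N)
    block i = ∑ℚ (λ r → φ ((ι r * unit M + ι i) * unit N)) (suc M)
    S = ∑ℚ block (suc N)
    step : ∀ i r → r ℕ.< suc M → (ι r * unit M + ι i) * unit N ≤ ι (suc i) * unit N
    step i r (s≤s r≤M) = ℚₚ.*-monoʳ-≤-nonNeg (unit N) {{ℚ.nonNegative (0≤unit N)}}
      (subst (ι r * unit M + ι i ≤_) (trans (ℚₚ.+-comm 1ℚ (ι i)) (sym (ι-suc i)))
        (ℚₚ.+-monoˡ-≤ (ι i) (ℚₚ.≤-trans (ℚₚ.*-monoʳ-≤-nonNeg (unit M) {{ℚ.nonNegative (0≤unit M)}} (ι-mono r≤M)) (ι*unit≤1 M))))

  -- Two grids are compared through their common refinement into (p+1)(q+1) intervals: it lies below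
  -- the sum for q, and below the sum for p by at most φ(0)/(p+1).
  leftSum-cauchy : IsCauchy leftSum
  leftSum-cauchy ε 0<ε =
    let N , h = unit-scaled-null (φ 0ℚ) (0<φ ℚₚ.≤-refl) ε 0<ε
    in N , λ p q N≤p N≤q → ∣p∣< (ℚₚ.≤-<-trans (close p q) (h p N≤p))
      (subst (_< ε) (solve 2 (λ a b → b :- a := :- (a :- b)) refl (leftSum p) (leftSum q)) (ℚₚ.≤-<-trans (close q p) (h q N≤q)))
    where
    ∣p∣< : ∀ {p q} → p < q → - p < q → ∣ p ∣ < q
    ∣p∣< {p} {q} p<q -p<q with ℚₚ.∣p∣≡p∨∣p∣≡-p p
    ... | inj₁ e = subst (_< q) (sym e) p<q
    ... | inj₂ e = subst (_< q) (sym e) -p<q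
    refine-comm : ∀ p q → q ℕ.+ p ℕ.* suc q ≡ p ℕ.+ q ℕ.* suc p
    refine-comm p q = solveℕ 2 (λ p q → q ⊞ p ⊠ (conℕ 1 ⊞ q) ⊜ p ⊞ q ⊠ (conℕ 1 ⊞ p)) refl p q
    close : ∀ p q → leftSum p - leftSum q ≤ φ 0ℚ * unit p
    close p q = subst (leftSum p - leftSum q ≤_)
      (solve 2 (λ a b → a :+ b :- b := a) refl (φ 0ℚ * unit p) (leftSum q))
      (ℚₚ.+-monoˡ-≤ (- leftSum q) (ℚₚ.≤-trans (≤-refine p q) (ℚₚ.+-monoʳ-≤ (φ 0ℚ * unit p)
        (subst (λ t → leftSum t ≤ leftSum q) (sym (refine-comm p q)) (refine-≤ q p)))))

-- Negative logarithms of 1/2ᵃ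

-- 2^a - 1, so that `unit (mersenne a)` is 2^(-a).
mersenne : ℕ → ℕ
mersenne zero    = 0
mersenne (suc a) = suc (mersenne a ℕ.+ mersenne a)

a≤mersenne : ∀ a → a ℕ.≤ mersenne a
a≤mersenne zero    = z≤n
a≤mersenne (suc a) = s≤s (ℕₚ.≤-trans (a≤mersenne a) (ℕₚ.m≤m+n (mersenne a) (mersenne a)))

-- The M + 1 added reciprocals run from 1/(M+1) to 1/(2M+1). Bounding each by 1/(2M+2) makes the
-- total exactly 1/2.
H-double : ∀ M → H M + ½ ≤ H (suc (M ℕ.+ M))
H-double M = subst (H M + ½ ≤_) (sym (∑-split unit (suc M) M)) (ℚₚ.+-monoʳ-≤ (H M)
  (subst (_≤ ∑ℚ (λ i → unit (i ℕ.+ M)) (suc M)) eq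
    (∑-mono-< (suc M) λ { i (s≤s i≤M) → unit-antimono (ℕₚ.≤-trans (ℕₚ.+-monoˡ-≤ M i≤M) (ℕₚ.n≤1+n (M ℕ.+ M))) })))
  where
  index : suc (M ℕ.+ M) ≡ M ℕ.+ 1 ℕ.* suc M
  index = trans (sym (ℕₚ.+-suc M M)) (cong (M ℕ.+_) (sym (ℕₚ.*-identityˡ (suc M))))
  eq : ∑ℚ (λ _ → unit (suc (M ℕ.+ M))) (suc M) ≡ ½
  eq = begin
    ∑ℚ (λ _ → unit (suc (M ℕ.+ M))) (suc M)   ≡⟨ ∑-const (unit (suc (M ℕ.+ M))) (suc M) ⟩
    ι (suc M) * unit (suc (M ℕ.+ M))          ≡⟨ cong (ι (suc M) *_) (trans (cong unit index) (unit-* 1 M)) ⟩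
    ι (suc M) * (½ * unit M)                  ≡⟨ solve 2 (λ i u → i :* (con ½ :* u) := con ½ :* (u :* i)) refl (ι (suc M)) (unit M) ⟩
    ½ * (unit M * ι (suc M))                  ≡⟨ cong (½ *_) (unit-ι M) ⟩
    ½ * 1ℚ                                    ≡⟨ ℚₚ.*-identityʳ ½ ⟩
    ½                                         ∎

-- The index on the right is (N+1) 2^a - 1. Raising a by one sends it from K to 2K + 1, which is one
-- application of `H-double`.
H-growth : ∀ N a → H N + ½ * ι a ≤ H (suc N ℕ.* mersenne a ℕ.+ N)
H-growth N zero    = ℚₚ.≤-reflexive (trans (solve 1 (λ h → h :+ con ½ :* con 0ℚ := h) refl (H N))
  (cong (λ t → H (t ℕ.+ N)) (sym (ℕₚ.*-zeroʳ N))))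
H-growth N (suc a) = subst₂ _≤_ eq (cong H (sym index))
  (ℚₚ.≤-trans (ℚₚ.+-monoˡ-≤ ½ (H-growth N a)) (H-double (suc N ℕ.* mersenne a ℕ.+ N)))
  where
  index : suc N ℕ.* mersenne (suc a) ℕ.+ N ≡ suc ((suc N ℕ.* mersenne a ℕ.+ N) ℕ.+ (suc N ℕ.* mersenne a ℕ.+ N))
  index = solveℕ 2 (λ n k → (conℕ 1 ⊞ n) ⊠ (conℕ 1 ⊞ (k ⊞ k)) ⊞ n
    ⊜ conℕ 1 ⊞ (((conℕ 1 ⊞ n) ⊠ k ⊞ n) ⊞ ((conℕ 1 ⊞ n) ⊠ k ⊞ n))) refl N (mersenne a)
  eq : H N + ½ * ι a + ½ ≡ H N + ½ * ι (suc a)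
  eq = trans (solve 2 (λ h i → h :+ con ½ :* i :+ con ½ := h :+ con ½ :* (i :+ con 1ℚ)) refl (H N) (ι a))
    (cong (λ t → H N + ½ * t) (sym (ι-suc a)))

1-unit : ∀ k → 1ℚ - unit k ≡ ι k * unit k
1-unit k = begin
  1ℚ - unit k                      ≡⟨ cong (_- unit k) (unit-ι k) ⟨
  unit k * ι (suc k) - unit k      ≡⟨ cong (λ t → unit k * t - unit k) (ι-suc k) ⟩
  unit k * (ι k + 1ℚ) - unit k     ≡⟨ solve 2 (λ u i → u :* (i :+ con 1ℚ) :- u := i :* u) refl (unit k) (ι k) ⟩
  ι k * unit k                     ∎

0<ι-suc : ∀ k → 0ℚ < ι (suc k)
0<ι-suc k = subst (0ℚ <_) (sym (ι-suc k)) (ℚₚ.+-mono-≤-< (0≤ι k) 0<1)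

*-recipℚ : ∀ {x y h} → 0ℚ < x → x * y ≡ h → h * recipℚ x ≡ y
*-recipℚ {x} {y} {h} 0<x xy≡h = begin
  h * recipℚ x        ≡⟨ cong (_* recipℚ x) xy≡h ⟨
  x * y * recipℚ x    ≡⟨ solve 3 (λ x y r → x :* y :* r := r :* x :* y) refl x y (recipℚ x) ⟩
  recipℚ x * x * y    ≡⟨ cong (_* y) (recipℚ-inverse 0<x) ⟩
  1ℚ * y              ≡⟨ ℚₚ.*-identityˡ y ⟩
  y                   ∎

-- 1/2ᵇ⁺¹
dyadic : ℕ → ℚ
dyadic b = unit (mersenne (suc b))

0<dyadic : ∀ b → 0ℚ < dyadic b
0<dyadic b = 0<unit (mersenne (suc b))

0<1-dyadic : ∀ b → 0ℚ < 1ℚ - dyadic b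
0<1-dyadic b = subst (0ℚ <_) (sym (1-unit (mersenne (suc b)))) (0<* (0<ι-suc (mersenne b ℕ.+ mersenne b)) (0<unit (mersenne (suc b))))

dyadic≤unit : ∀ b → dyadic b ≤ unit b
dyadic≤unit b = unit-antimono (ℕₚ.≤-trans (ℕₚ.n≤1+n b) (a≤mersenne (suc b)))

module _ (b : ℕ) where

  private
    e = dyadic b
    -- `suc κ` is 2^(b+1) - 1, hence 1 - e is `suc κ` times e.
    κ = mersenne b ℕ.+ mersenne b

    -- The integrand 1/t on [e, 1], pulled back to [0, 1] along t ↦ e + t (1 - e); the factor 1 - e
    -- is the Jacobian.
    φ : ℚ → ℚ
    φ t = (1ℚ - e) * recipℚ (e + t * (1ℚ - e))

    0<base : ∀ {t} → 0ℚ ≤ t → 0ℚ < e + t * (1ℚ - e)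
    0<base 0≤t = 0<+ (0<dyadic b) (0≤* 0≤t (ℚₚ.<⇒≤ (0<1-dyadic b)))

    0<φ : ∀ {t} → 0ℚ ≤ t → 0ℚ < φ t
    0<φ 0≤t = 0<* (0<1-dyadic b) (recipℚ-pos (0<base 0≤t))

    φ-antitone : ∀ {s t} → 0ℚ ≤ s → s ≤ t → φ t ≤ φ s
    φ-antitone 0≤s s≤t = *-monoˡ (ℚₚ.<⇒≤ (0<1-dyadic b)) (recipℚ-antimono (0<base 0≤s)
      (ℚₚ.+-monoʳ-≤ e (ℚₚ.*-monoʳ-≤-nonNeg (1ℚ - e) {{ℚ.nonNegative (ℚₚ.<⇒≤ (0<1-dyadic b))}} s≤t)))

  open RiemannSums φ 0<φ φ-antitone

  negLog : ℝ
  negLog = mkℝ leftSum leftSum-cauchy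

  -- On a grid of (N+1)(2ᵇ⁺¹-1) intervals the Riemann sum of 1/t is a sum of
  -- consecutive reciprocals of integers.
  leftSum-harmonic : ∀ N → leftSum (κ ℕ.+ N ℕ.* suc κ) ≡ ∑ℚ (λ i → unit (i ℕ.+ N)) (suc N ℕ.* mersenne (suc b))
  leftSum-harmonic N = trans (sym (∑-*ˡ (unit Q) (λ i → φ (ι i * unit Q)) (suc Q))) (∑-cong reciprocal (suc Q))
    where
    Q = κ ℕ.+ N ℕ.* suc κ
    -- The width of an interval of this grid, by `width`. As e is N + 1 times `h`, node i is (i + N
    -- + 1) h, and dividing `h` by it gives the reciprocal of an integer.
    h = unit N * e
    width : unit Q * (1ℚ - e) ≡ h
    width = begin
      unit Q * (1ℚ - e)                       ≡⟨ cong₂ _*_ (unit-* N κ) (1-unit (suc κ)) ⟩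
      unit N * unit κ * (ι (suc κ) * e)       ≡⟨ solve 4 (λ n k i e → n :* k :* (i :* e) := n :* (k :* i :* e)) refl (unit N) (unit κ) (ι (suc κ)) e ⟩
      unit N * (unit κ * ι (suc κ) * e)       ≡⟨ cong (λ t → unit N * (t * e)) (unit-ι κ) ⟩
      unit N * (1ℚ * e)                       ≡⟨ cong (unit N *_) (ℚₚ.*-identityˡ e) ⟩
      h                                       ∎
    reciprocal : ∀ i → unit Q * φ (ι i * unit Q) ≡ unit (i ℕ.+ N)
    reciprocal i = begin
      unit Q * ((1ℚ - e) * recipℚ x)          ≡⟨ ℚₚ.*-assoc (unit Q) (1ℚ - e) (recipℚ x) ⟨
      unit Q * (1ℚ - e) * recipℚ x            ≡⟨ cong (_* recipℚ x) width ⟩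
      h * recipℚ x                            ≡⟨ *-recipℚ (0<base (0≤grid i Q)) eq ⟩
      unit (i ℕ.+ N)                          ∎
      where
      x = e + ι i * unit Q * (1ℚ - e)
      v = unit (i ℕ.+ N)
      eq : x * v ≡ h
      eq = begin
        (e + ι i * unit Q * (1ℚ - e)) * v
          ≡⟨ cong (λ t → (e + t) * v) (trans (ℚₚ.*-assoc (ι i) (unit Q) (1ℚ - e)) (cong (ι i *_) width)) ⟩
        (e + ι i * (unit N * e)) * v
          ≡⟨ solve 4 (λ e i n v → (e :+ i :* (n :* e)) :* v := (con 1ℚ :* e :+ i :* (n :* e)) :* v) refl e (ι i) (unit N) v ⟩
        (1ℚ * e + ι i * (unit N * e)) * v
          ≡⟨ cong (λ t → (t * e + ι i * (unit N * e)) * v) (unit-ι N) ⟨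
        (unit N * ι (suc N) * e + ι i * (unit N * e)) * v
          ≡⟨ solve 5 (λ e i n s v → (n :* s :* e :+ i :* (n :* e)) :* v := v :* (i :+ s) :* (n :* e)) refl e (ι i) (unit N) (ι (suc N)) v ⟩
        v * (ι i + ι (suc N)) * h
          ≡⟨ cong (λ t → v * t * h) (trans (sym (ι-+ i (suc N))) (cong ι (ℕₚ.+-suc i N))) ⟩
        v * ι (suc (i ℕ.+ N)) * h
          ≡⟨ cong (_* h) (unit-ι (i ℕ.+ N)) ⟩
        1ℚ * h
          ≡⟨ ℚₚ.*-identityˡ h ⟩
        h ∎

  -- Refining each interval into `suc κ` pieces can only lower the left sum, and on the refined grid
  -- it is a difference of harmonic sums, to which `H-growth` applies with b + 1 doublings.
  negLog-≥ : ∀ N → ½ * ι (suc b) ≤ seq negLog N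
  negLog-≥ N = ℚₚ.≤-trans
    (subst₂ _≤_ (solve 2 (λ h x → h :+ x :- h := x) refl (H N) (½ * ι (suc b)))
      (trans (cong (_- H N) (∑-split unit (suc N ℕ.* mersenne (suc b)) N))
        (solve 2 (λ h x → h :+ x :- h := x) refl (H N) (∑ℚ (λ i → unit (i ℕ.+ N)) (suc N ℕ.* mersenne (suc b)))))
      (ℚₚ.+-monoˡ-≤ (- H N) (H-growth N (suc b))))
    (subst (_≤ leftSum N) (leftSum-harmonic N) (refine-≤ N κ))

  leftSum≡ : ∀ N → ∑ℚ (λ i → unit N * (1ℚ - e) * recipℚ (e + ((ℤ.+ i) ℚ./ suc N) * (1ℚ - e))) (suc N) ≡ leftSum N
  leftSum≡ N = trans
    (∑-cong (λ i → trans (ℚₚ.*-assoc (unit N) (1ℚ - e) (recipℚ (e + ((ℤ.+ i) ℚ./ suc N) * (1ℚ - e))))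
      (cong (λ t → unit N * ((1ℚ - e) * recipℚ (e + t * (1ℚ - e)))) (/-unit i N))) (suc N))
    (∑-*ˡ (unit N) (λ i → φ (ι i * unit N)) (suc N))

-- Limits of rational sequences

∑ℝ-seq : ∀ (f : ℕ → ℝ) (g : ℕ → ℚ) p → (∀ k → seq (f k) p ≡ g k) → ∀ N → seq (∑ℝ f N) p ≡ ∑ℚ g N
∑ℝ-seq f g p f≡g zero    = refl
∑ℝ-seq f g p f≡g (suc N) = cong₂ _+_ (∑ℝ-seq f g p f≡g N) (f≡g N)

-- Each `a N` is a constant sequence, so its distance to the limit at index p is that of g N and g
-- p, and the Cauchy condition suffices. Halving δ′ leaves the gap that the strict order of reals
-- demands.
⟶-rational : ∀ (a : ℕ → ℝ) {g} (c : IsCauchy g) → (∀ N p → seq (a N) p ≡ g N) → a ⟶ mkℝ g c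
⟶-rational a {g} c a≡g δ (δ′ , 0<δ′ , N₁ , h₁) =
  let N₂ , h₂ = c (½ * δ′) (0<½* 0<δ′)
  in N₂ , λ N N₂≤N → ½ * δ′ , 0<½* 0<δ′ , N₁ ℕ.⊔ N₂ , λ p N≤p →
    subst (λ t → ∣ t - g p ∣ + ½ * δ′ < seq δ p) (sym (a≡g N p))
      (ℚₚ.<-trans
        (subst (∣ g N - g p ∣ + ½ * δ′ <_) (trans (½+½ δ′) (sym (ℚₚ.+-identityˡ δ′)))
          (ℚₚ.+-monoˡ-< (½ * δ′) (h₂ N p N₂≤N (ℕₚ.m⊔n≤o⇒n≤o N₁ N₂ N≤p))))
        (h₁ p (ℕₚ.m⊔n≤o⇒m≤o N₁ N₂ N≤p)))

fromℚ-< : ∀ {p q} → p < q → fromℚ p D.< fromℚ q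
fromℚ-< {p} {q} p<q = ½ * (q - p) , 0<½d , 0 , λ _ _ → subst₂ _<_ (ℚₚ.+-identityʳ (p + ½ * (q - p)))
    (solve 2 (λ p q → p :+ con ½ :* (q :- p) :+ con ½ :* (q :- p) := q) refl p q)
    (ℚₚ.+-monoʳ-< (p + ½ * (q - p)) 0<½d)
  where
  0<½d : 0ℚ < ½ * (q - p)
  0<½d = 0<½* (subst (_< q - p) (ℚₚ.+-inverseʳ p) (ℚₚ.+-monoˡ-< (- p) p<q))

dyadic<1 : ∀ b → dyadic b < 1ℚ
dyadic<1 b = subst₂ _<_ (ℚₚ.+-identityʳ (dyadic b)) (solve 1 (λ e → e :+ (con 1ℚ :- e) := con 1ℚ) refl (dyadic b))
  (ℚₚ.+-monoʳ-< (dyadic b) (0<1-dyadic b))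

isNegLog-rational : ∀ e 0<e e<1 {g} (c : IsCauchy g) →
  (∀ N → ∑ℚ (λ i → unit N * (1ℚ - e) * recipℚ (e + ((ℤ.+ i) ℚ./ suc N) * (1ℚ - e))) (suc N) ≡ g N) →
  IsNegLog (fromℚ e) 0<e e<1 (mkℝ g c)
isNegLog-rational e 0<e e<1 c sums≡g = ⟶-rational riemannSum c λ N p →
  trans (∑ℝ-seq (summand N) (λ i → unit N * (1ℚ - e) * recipℚ (e + ((ℤ.+ i) ℚ./ suc N) * (1ℚ - e))) p (λ _ → refl) (suc N)) (sums≡g N)
  where
  summand : ℕ → ℕ → ℝ
  summand N i = fromℚ (unit N) D.* (1ℝ D.- fromℚ e) D.* recip (node (fromℚ e) N i) (0<node (fromℚ e) 0<e e<1 N i)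
  riemannSum : ℕ → ℝ
  riemannSum N = ∑ℝ (summand N) (suc N)

isNegLog : ∀ b → IsNegLog (fromℚ (dyadic b)) (fromℚ-< (0<dyadic b)) (fromℚ-< (dyadic<1 b)) (negLog b)
isNegLog b = isNegLog-rational (dyadic b) (fromℚ-< (0<dyadic b)) (fromℚ-< (dyadic<1 b)) (cauchy (negLog b)) (leftSum≡ b)

-- Abel summation

^-seq : ∀ {x q} → (∀ p → seq x p ≡ q) → ∀ k p → seq (x D.^ k) p ≡ q ^ k
^-seq x≡q zero    p = refl
^-seq x≡q (suc k) p = cong₂ _*_ (x≡q p) (^-seq x≡q k p)

*-fromℚ-seq : ∀ x {p q} → seq x p ≡ q → ∀ t → seq (x D.* fromℚ t) p ≡ q * t
*-fromℚ-seq x x≡q t = cong (_* t) x≡q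

rational-hasSum : ∀ (f : ℕ → ℝ) (g : ℕ → ℚ) → (∀ k p → seq (f k) p ≡ g k) → (c : IsCauchy (∑ℚ g)) → HasSum f (∑∞ g c)
rational-hasSum f g f≡g c = ⟶-rational (∑ℝ f) c λ N p → ∑ℝ-seq f g p (λ k → f≡g k p) N

power-seq : ∀ x q → (∀ p → seq x p ≡ q) → ∀ n t p → seq (x D.^ n D.* fromℚ t) p ≡ q ^ n * t
power-seq x q x≡q n t p = *-fromℚ-seq (x D.^ n) {p} {q ^ n} (^-seq {x} {q} x≡q n p) t

0≤^ : ∀ {x} → 0ℚ ≤ x → ∀ k → 0ℚ ≤ x ^ k
0≤^ 0≤x zero    = 0≤1
0≤^ 0≤x (suc k) = 0≤* 0≤x (0≤^ 0≤x k)

^≤1 : ∀ {x} → 0ℚ ≤ x → x ≤ 1ℚ → ∀ k → x ^ k ≤ 1ℚ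
^≤1 0≤x x≤1 zero    = ℚₚ.≤-refl
^≤1 0≤x x≤1 (suc k) = *-mono-≤ (0≤^ 0≤x k) 0≤1 x≤1 (^≤1 0≤x x≤1 k)

bernoulli : ∀ {e} → 0ℚ ≤ e → e ≤ 1ℚ → ∀ k → 1ℚ - (1ℚ - e) ^ k ≤ ι k * e
bernoulli {e} 0≤e e≤1 zero    = ℚₚ.≤-reflexive (sym (ℚₚ.*-zeroˡ e))
bernoulli {e} 0≤e e≤1 (suc k) = subst₂ _≤_
  (solve 2 (λ e x → (con 1ℚ :- x) :+ e :* x := con 1ℚ :- (con 1ℚ :- e) :* x) refl e ((1ℚ - e) ^ k))
  (trans (solve 2 (λ e i → i :* e :+ e :* con 1ℚ := (i :+ con 1ℚ) :* e) refl e (ι k)) (cong (_* e) (sym (ι-suc k))))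
  (ℚₚ.+-mono-≤ (bernoulli 0≤e e≤1 k) (*-monoˡ 0≤e (^≤1 (≤⇒0≤- e≤1) 1-e≤1 k)))
  where
  1-e≤1 : 1ℚ - e ≤ 1ℚ
  1-e≤1 = subst (1ℚ - e ≤_) (ℚₚ.+-identityʳ 1ℚ) (ℚₚ.+-monoʳ-≤ 1ℚ (ℚₚ.neg-antimono-≤ 0≤e))

module AbelSums (j : ℕ) (j>1 : 1 ℕ.< j) (e : ℚ) (0≤e : 0ℚ ≤ e) (e≤1 : e ≤ 1ℚ) where

  abelTerm : ℕ → ℚ
  abelTerm k = (1ℚ - e) ^ suc k * term j k

  defect : ℕ → ℚ
  defect k = (1ℚ - (1ℚ - e) ^ suc k) * term j k

  0≤x : 0ℚ ≤ 1ℚ - e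
  0≤x = ≤⇒0≤- e≤1

  x≤1 : 1ℚ - e ≤ 1ℚ
  x≤1 = subst (1ℚ - e ≤_) (ℚₚ.+-identityʳ 1ℚ) (ℚₚ.+-monoʳ-≤ 1ℚ (ℚₚ.neg-antimono-≤ 0≤e))

  0≤abelTerm : ∀ k → 0ℚ ≤ abelTerm k
  0≤abelTerm k = 0≤* (0≤^ 0≤x (suc k)) (0≤term j k)

  abelTerm≤ : ∀ k → abelTerm k ≤ (H k + 1ℚ) * (unit k * unit k)
  abelTerm≤ k = *-mono-≤ (0≤term j k) (0≤+ (0≤H k) 0≤1)
    (ℚₚ.≤-trans (^≤1 0≤x x≤1 (suc k)) (subst (_≤ H k + 1ℚ) (ℚₚ.+-identityˡ 1ℚ) (ℚₚ.+-monoˡ-≤ 1ℚ (0≤H k))))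
    (term≤unit² j k j>1)

  abelSum : ℝ
  abelSum = ∑∞ abelTerm (converges abelTerm 0≤abelTerm abelTerm≤)

  hasAbelSum : ∀ f → (∀ k p → seq (f k) p ≡ abelTerm k) → HasSum f abelSum
  hasAbelSum f f≡abelTerm = rational-hasSum f abelTerm f≡abelTerm (cauchy abelSum)

  Z-abelSum : ∀ p → Z j p - seq abelSum p ≡ ∑ℚ defect p
  Z-abelSum p = trans (sym (∑-- (term j) abelTerm p))
    (∑-cong (λ k → solve 2 (λ x t → t :- x :* t := (con 1ℚ :- x) :* t) refl ((1ℚ - e) ^ suc k) (term j k)) p)

  0≤defect : ∀ k → 0ℚ ≤ defect k
  0≤defect k = 0≤* (≤⇒0≤- (^≤1 0≤x x≤1 (suc k))) (0≤term j k)

  defect≤term : ∀ k → defect k ≤ term j k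
  defect≤term k = subst (defect k ≤_) (ℚₚ.*-identityˡ (term j k))
    (ℚₚ.*-monoʳ-≤-nonNeg (term j k) {{ℚ.nonNegative (0≤term j k)}}
      (subst (1ℚ - (1ℚ - e) ^ suc k ≤_) (ℚₚ.+-identityʳ 1ℚ) (ℚₚ.+-monoʳ-≤ 1ℚ (ℚₚ.neg-antimono-≤ (0≤^ 0≤x (suc k))))))

  -- Bernoulli's inequality bounds the first factor by (k+1) e, and the second is at most 1/(k+1).
  defect≤e : ∀ k → defect k ≤ e
  defect≤e k = subst (defect k ≤_) eq
    (*-mono-≤ (0≤term j k) (0≤* (0≤ι (suc k)) 0≤e) (bernoulli 0≤e e≤1 (suc k)) (term≤unit j k (ℕₚ.<⇒≤ j>1)))
    where
    eq : ι (suc k) * e * unit k ≡ e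
    eq = begin
      ι (suc k) * e * unit k     ≡⟨ solve 3 (λ i e u → i :* e :* u := u :* i :* e) refl (ι (suc k)) e (unit k) ⟩
      unit k * ι (suc k) * e     ≡⟨ cong (_* e) (unit-ι k) ⟩
      1ℚ * e                     ≡⟨ ℚₚ.*-identityˡ e ⟩
      e                          ∎

  -- The first N defects are at most e each; the later ones are bounded by a tail of ζ(j), which is
  -- independent of e.
  ∑defect≤ : ∀ N d → ∑ℚ defect (d ℕ.+ N) ≤ ι N * e + (Z j (d ℕ.+ N) - Z j N)
  ∑defect≤ N d = subst₂ _≤_ (sym (∑-split defect d N)) (cong (ι N * e +_) tail)
    (ℚₚ.+-mono-≤ (subst (∑ℚ defect N ≤_) (∑-const e N) (∑ℚ-mono defect≤e N)) (∑ℚ-mono (λ k → defect≤term (k ℕ.+ N)) d))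
    where
    tail : ∑ℚ (λ k → term j (k ℕ.+ N)) d ≡ Z j (d ℕ.+ N) - Z j N
    tail = trans (solve 2 (λ z t → t := z :+ t :- z) refl (Z j N) (∑ℚ (λ k → term j (k ℕ.+ N)) d))
      (cong (_- Z j N) (sym (∑-split (term j) d N)))

  ∣Z-abelSum∣≤ : ∀ N p → N ℕ.≤ p → ∣ Z j p - seq abelSum p ∣ ≤ ι N * e + ∣ Z j p - Z j N ∣
  ∣Z-abelSum∣≤ N p N≤p = subst (_≤ ι N * e + ∣ Z j p - Z j N ∣)
    (sym (trans (cong ∣_∣ (Z-abelSum p)) (ℚₚ.0≤p⇒∣p∣≡p (∑ℚ-nonNeg 0≤defect p))))
    (ℚₚ.≤-trans (subst (λ t → ∑ℚ defect t ≤ ι N * e + (Z j t - Z j N)) (ℕₚ.m∸n+n≡m N≤p) (∑defect≤ N (p ∸ N)))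
      (ℚₚ.+-monoʳ-≤ (ι N * e) (p≤∣p∣ (Z j p - Z j N))))

open AbelSums using (abelSum; hasAbelSum; ∣Z-abelSum∣≤)

abel : ∀ j (j>1 : 1 ℕ.< j) δ → 0ℚ < δ → ∃ λ N → ∃ λ M → ∀ e (0≤e : 0ℚ ≤ e) (e≤1 : e ≤ 1ℚ) → e ≤ unit M →
  ∀ p → N ℕ.≤ p → ∣ Z j p - seq (abelSum j j>1 e 0≤e e≤1) p ∣ < δ
abel j j>1 δ 0<δ = proof₁ (cauchy (ζ j j>1) (½ * δ) (0<½* 0<δ))
  where
  Estimate : ℕ → ℕ → Set
  Estimate N M = ∀ e (0≤e : 0ℚ ≤ e) (e≤1 : e ≤ 1ℚ) → e ≤ unit M →
    ∀ p → N ℕ.≤ p → ∣ Z j p - seq (abelSum j j>1 e 0≤e e≤1) p ∣ < δ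
  proof₁ : (∃ λ N → ∀ p q → N ℕ.≤ p → N ℕ.≤ q → ∣ Z j p - Z j q ∣ < ½ * δ) → ∃ λ N → ∃ λ M → Estimate N M
  -- N is fixed by the tail of ζ(j) before e is known; M then makes N e small. The scale is N + 1
  -- rather than N because it must be positive.
  proof₁ (N , h) = N , proof₂ (unit-scaled-null (ι N + 1ℚ) (ℚₚ.+-mono-≤-< (0≤ι N) 0<1) (½ * δ) (0<½* 0<δ))
    where
    proof₂ : (Eventually λ k → (ι N + 1ℚ) * unit k < ½ * δ) → ∃ (Estimate N)
    proof₂ (M , h′) = M , λ e 0≤e e≤1 e≤unit p N≤p →
      ℚₚ.≤-<-trans (∣Z-abelSum∣≤ j j>1 e 0≤e e≤1 N p N≤p)
        (subst (ι N * e + ∣ Z j p - Z j N ∣ <_) (½+½ δ)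
          (ℚₚ.+-mono-< (ℚₚ.≤-<-trans (*-mono-≤ {ι N} {ι N + 1ℚ} {e} {unit M} 0≤e (0≤+ (0≤ι N) 0≤1) (p≤p+q 0≤1) e≤unit) (h′ M ℕₚ.≤-refl))
                       (h p N N≤p ℕₚ.≤-refl)))

-- Regularised zeta values

∣p-r∣≤∣p-q∣+∣q-r∣ : ∀ p q r → ∣ p - r ∣ ≤ ∣ p - q ∣ + ∣ q - r ∣
∣p-r∣≤∣p-q∣+∣q-r∣ p q r = subst (λ t → ∣ t ∣ ≤ ∣ p - q ∣ + ∣ q - r ∣)
  (solve 3 (λ p q r → (p :- q) :+ (q :- r) := p :- r) refl p q r) (ℚₚ.∣p+q∣≤∣p∣+∣q∣ (p - q) (q - r))

fromℚ-<-half : ∀ e η {η′} → 0ℚ < η′ → (Eventually λ p → 0ℚ + η′ < seq η p) → e < ½ * η′ → fromℚ e D.< η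
fromℚ-<-half e η {η′} 0<η′ (N , h) e<½η′ = ½ * η′ , 0<½* 0<η′ , N , λ p N≤p → ℚₚ.<-trans
  (subst (e + ½ * η′ <_) (trans (½+½ η′) (sym (ℚₚ.+-identityˡ η′))) (ℚₚ.+-monoˡ-< (½ * η′) e<½η′))
  (h p N≤p)

CloseTo : (j : ℕ) (c₀ c₁ l : ℝ) (δ : ℚ) → Set
CloseTo j c₀ c₁ l δ = Eventually λ p → ∣ Z j p - (seq c₀ p + seq c₁ p * seq l p) ∣ < δ

asymptotics-rational : ∀ j → 1 ℕ.< j → ∀ c₀ c₁ → ShuffleAsymptotics j c₀ c₁ → ∀ δ → 0ℚ < δ →
  ∃ λ M → ∀ e (0<e : 0ℚ < e) (e<1 : e < 1ℚ) → e ≤ unit M → ∀ l → IsNegLog (fromℚ e) (fromℚ-< 0<e) (fromℚ-< e<1) l →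
  CloseTo j c₀ c₁ l δ
asymptotics-rational j j>1 c₀ c₁ asym δ 0<δ =
  proof₁ (asym (fromℚ (½ * δ)) (fromℚ-< (0<½* 0<δ))) (abel j j>1 (½ * δ) (0<½* 0<δ))
  where
  proof₁ : _ → _ → _
  proof₁ (η , (η′ , 0<η′ , η′<η) , close) (N₁ , M₁ , h₁) = proof₂ (archimedean (½ * η′) (0<½* 0<η′))
    where
    proof₂ : (∃ λ M → unit M < ½ * η′) → _
    proof₂ (M₂ , unit<½η′) = M₁ ℕ.⊔ M₂ , conclude
      where
      conclude : ∀ e (0<e : 0ℚ < e) (e<1 : e < 1ℚ) → e ≤ unit (M₁ ℕ.⊔ M₂) → ∀ l →
        IsNegLog (fromℚ e) (fromℚ-< 0<e) (fromℚ-< e<1) l → CloseTo j c₀ c₁ l δ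
      conclude e 0<e e<1 e≤unit l l≡-log = proof₃
        (close (fromℚ e) (fromℚ-< 0<e) (fromℚ-< e<1)
          (fromℚ-<-half e η 0<η′ η′<η (ℚₚ.≤-<-trans (ℚₚ.≤-trans e≤unit (unit-antimono (ℕₚ.m≤n⊔m M₁ M₂))) unit<½η′)) s l
          (hasAbelSum j j>1 e (ℚₚ.<⇒≤ 0<e) (ℚₚ.<⇒≤ e<1) _
            (λ k p → power-seq (1ℝ D.- fromℚ e) (1ℚ - e) (λ _ → refl) (suc k) (term j k) p)) l≡-log)
        where
        s = abelSum j j>1 e (ℚₚ.<⇒≤ 0<e) (ℚₚ.<⇒≤ e<1)
        proof₃ : (∃ λ δ″ → 0ℚ < δ″ × Eventually λ p → ∣ seq s p - (seq c₀ p + seq c₁ p * seq l p) ∣ + δ″ < ½ * δ) → CloseTo j c₀ c₁ l δ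
        proof₃ (δ″ , 0<δ″ , N₂ , h₂) = N₁ ℕ.⊔ N₂ , λ p N≤p →
          ℚₚ.≤-<-trans (∣p-r∣≤∣p-q∣+∣q-r∣ (Z j p) (seq s p) (seq c₀ p + seq c₁ p * seq l p))
            (subst (∣ Z j p - seq s p ∣ + ∣ seq s p - (seq c₀ p + seq c₁ p * seq l p) ∣ <_) (½+½ δ)
              (ℚₚ.+-mono-<
                (h₁ e (ℚₚ.<⇒≤ 0<e) (ℚₚ.<⇒≤ e<1) (ℚₚ.≤-trans e≤unit (unit-antimono (ℕₚ.m≤m⊔n M₁ M₂))) p (ℕₚ.m⊔n≤o⇒m≤o N₁ N₂ N≤p))
                (ℚₚ.≤-<-trans (p≤p+q (ℚₚ.<⇒≤ 0<δ″)) (h₂ p (ℕₚ.m⊔n≤o⇒n≤o N₁ N₂ N≤p)))))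

-- At these points a value of -log is at hand, namely `negLog b`, and it grows with b.
asymptotics-dyadic : ∀ j → 1 ℕ.< j → ∀ c₀ c₁ → ShuffleAsymptotics j c₀ c₁ → ∀ δ → 0ℚ < δ →
  Eventually λ b → CloseTo j c₀ c₁ (negLog b) δ
asymptotics-dyadic j j>1 c₀ c₁ asym δ 0<δ = proof (asymptotics-rational j j>1 c₀ c₁ asym δ 0<δ)
  where
  proof : _ → _
  proof (M , h) = M , λ b M≤b → h (dyadic b) (0<dyadic b) (dyadic<1 b)
    (ℚₚ.≤-trans (dyadic≤unit b) (unit-antimono M≤b)) (negLog b) (isNegLog b)

-- The chain is (b+1)/2 |d| ≤ |d l| ≤ |z - c| + 1 ≤ B + 1, multiplied by 1/(b+1).
c₁-bound : ∀ b z c d {B l} → ½ * ι (suc b) ≤ l → ∣ z - c ∣ ≤ B → ∣ z - (c + d * l) ∣ < 1ℚ → ½ * ∣ d ∣ ≤ (B + 1ℚ) * unit b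
c₁-bound b z c d {B} {l} ½ιb≤l z-c≤B close = subst (_≤ (B + 1ℚ) * unit b) eq
  (ℚₚ.*-monoʳ-≤-nonNeg (unit b) {{ℚ.nonNegative (0≤unit b)}} (ℚₚ.≤-trans scaled total))
  where
  0≤l : 0ℚ ≤ l
  0≤l = ℚₚ.≤-trans (0≤* {½} (ℚₚ.nonNegative⁻¹ ½) (0≤ι (suc b))) ½ιb≤l
  scaled : ½ * ι (suc b) * ∣ d ∣ ≤ ∣ d * l ∣
  scaled = subst (½ * ι (suc b) * ∣ d ∣ ≤_)
    (trans (ℚₚ.*-comm l ∣ d ∣) (trans (cong (∣ d ∣ *_) (sym (ℚₚ.0≤p⇒∣p∣≡p 0≤l))) (sym (ℚₚ.∣p*q∣≡∣p∣*∣q∣ d l))))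
    (ℚₚ.*-monoʳ-≤-nonNeg ∣ d ∣ {{ℚₚ.∣-∣-nonNeg d}} ½ιb≤l)
  total : ∣ d * l ∣ ≤ B + 1ℚ
  total = ℚₚ.≤-trans (∣p∣≤∣q∣+∣p-q∣ (d * l) (z - c)) (ℚₚ.+-mono-≤ z-c≤B (ℚₚ.<⇒≤ (subst (_< 1ℚ)
    (trans (cong ∣_∣ (solve 3 (λ z c x → z :- (c :+ x) := (z :- c) :- x) refl z c (d * l))) (∣p-q∣≡∣q-p∣ (z - c) (d * l)))
    close)))
  eq : ½ * ι (suc b) * ∣ d ∣ * unit b ≡ ½ * ∣ d ∣
  eq = begin
    ½ * ι (suc b) * ∣ d ∣ * unit b     ≡⟨ solve 3 (λ i d u → con ½ :* i :* d :* u := con ½ :* (u :* i :* d)) refl (ι (suc b)) ∣ d ∣ (unit b) ⟩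
    ½ * (unit b * ι (suc b) * ∣ d ∣)   ≡⟨ cong (λ x → ½ * (x * ∣ d ∣)) (unit-ι b) ⟩
    ½ * (1ℚ * ∣ d ∣)                   ≡⟨ cong (½ *_) (ℚₚ.*-identityˡ ∣ d ∣) ⟩
    ½ * ∣ d ∣                          ∎

-- Accuracy 1 in the asymptotics is enough: `c₁` is fixed while b may be taken as large as desired
-- in `c₁-bound`.
asymptotics⇒c₁-null : ∀ j → 1 ℕ.< j → ∀ c₀ c₁ → ShuffleAsymptotics j c₀ c₁ → IsNull (seq c₁)
asymptotics⇒c₁-null j j>1 c₀ c₁ asym t 0<t =
  proof₁ (eventuallyBounded (ζ j j>1 D.- c₀)) (asymptotics-dyadic j j>1 c₀ c₁ asym 1ℚ 0<1)
  where
  proof₁ : Bounded (λ p → Z j p - seq c₀ p) → (Eventually λ b → CloseTo j c₀ c₁ (negLog b) 1ℚ) → Eventually λ p → ∣ seq c₁ p ∣ < t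
  proof₁ (B , 0<B , N₁ , h₁) (M₁ , close) = proof₂ (unit-scaled-null (B + 1ℚ) (0<+ 0<B 0≤1) (½ * t) (0<½* 0<t))
    where
    proof₂ : (Eventually λ b → (B + 1ℚ) * unit b < ½ * t) → Eventually λ p → ∣ seq c₁ p ∣ < t
    proof₂ (M₂ , small) = proof₃ (M₁ ℕ.⊔ M₂) (close (M₁ ℕ.⊔ M₂) (ℕₚ.m≤m⊔n M₁ M₂)) (small (M₁ ℕ.⊔ M₂) (ℕₚ.m≤n⊔m M₁ M₂))
      where
      proof₃ : ∀ b → CloseTo j c₀ c₁ (negLog b) 1ℚ → (B + 1ℚ) * unit b < ½ * t → Eventually λ p → ∣ seq c₁ p ∣ < t
      proof₃ b (N₂ , h₂) small = N₁ ℕ.⊔ N₂ , λ p N≤p → ℚₚ.*-cancelˡ-<-nonNeg ½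
        (ℚₚ.≤-<-trans
          (c₁-bound b (Z j p) (seq c₀ p) (seq c₁ p) (negLog-≥ b p)
            (h₁ p (ℕₚ.m⊔n≤o⇒m≤o N₁ N₂ N≤p)) (h₂ p (ℕₚ.m⊔n≤o⇒n≤o N₁ N₂ N≤p)))
          small)

-- One sufficiently small dyadic point will do: its `negLog` is a fixed real, hence bounded, so its
-- product with the null sequence `c₁` is null.
asymptotics⇒c₀≈ζ : ∀ j → 1 ℕ.< j → ∀ c₀ c₁ → ShuffleAsymptotics j c₀ c₁ → IsNull (λ p → Z j p - seq c₀ p)
asymptotics⇒c₀≈ζ j j>1 c₀ c₁ asym δ 0<δ = proof₁ (asymptotics-dyadic j j>1 c₀ c₁ asym (½ * δ) (0<½* 0<δ))
  where
  proof₁ : (Eventually λ b → CloseTo j c₀ c₁ (negLog b) (½ * δ)) → Eventually λ p → ∣ Z j p - seq c₀ p ∣ < δ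
  proof₁ (M , close) = proof₂ (negLog M) (close M ℕₚ.≤-refl)
    (null-* (eventuallyBounded (negLog M)) (asymptotics⇒c₁-null j j>1 c₀ c₁ asym) (½ * δ) (0<½* 0<δ))
    where
    proof₂ : ∀ l → CloseTo j c₀ c₁ l (½ * δ) → (Eventually λ p → ∣ seq l p * seq c₁ p ∣ < ½ * δ) → Eventually λ p → ∣ Z j p - seq c₀ p ∣ < δ
    proof₂ l (N₁ , h₁) (N₂ , h₂) = N₁ ℕ.⊔ N₂ , λ p N≤p → ℚₚ.≤-<-trans
      (subst (λ t → ∣ t ∣ ≤ ∣ Z j p - (seq c₀ p + seq c₁ p * seq l p) ∣ + ∣ seq l p * seq c₁ p ∣)
        (solve 4 (λ z c d l → z :- (c :+ d :* l) :+ l :* d := z :- c) refl (Z j p) (seq c₀ p) (seq c₁ p) (seq l p))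
        (ℚₚ.∣p+q∣≤∣p∣+∣q∣ (Z j p - (seq c₀ p + seq c₁ p * seq l p)) (seq l p * seq c₁ p)))
      (subst (∣ Z j p - (seq c₀ p + seq c₁ p * seq l p) ∣ + ∣ seq l p * seq c₁ p ∣ <_) (½+½ δ)
        (ℚₚ.+-mono-< (h₁ p (ℕₚ.m⊔n≤o⇒m≤o N₁ N₂ N≤p)) (h₂ p (ℕₚ.m⊔n≤o⇒n≤o N₁ N₂ N≤p))))

-- Coefficients of the right-hand side

coeff-⊕ : ∀ f g k p → seq (coeff (f ⊕ g) k) p ≡ seq (coeff f k) p + seq (coeff g k) p
coeff-⊕ []      g       k       p = sym (ℚₚ.+-identityˡ (seq (coeff g k) p))
coeff-⊕ (a ∷ f) []      k       p = sym (ℚₚ.+-identityʳ (seq (coeff (a ∷ f) k) p))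
coeff-⊕ (a ∷ f) (b ∷ g) zero    p = refl
coeff-⊕ (a ∷ f) (b ∷ g) (suc k) p = coeff-⊕ f g k p

coeff-· : ∀ a f k p → seq (coeff (a · f) k) p ≡ seq a p * seq (coeff f k) p
coeff-· a []      k       p = sym (ℚₚ.*-zeroʳ (seq a p))
coeff-· a (b ∷ f) zero    p = refl
coeff-· a (b ∷ f) (suc k) p = coeff-· a f k p

coeff-neg : ∀ f k p → seq (coeff (List.map D.-_ f) k) p ≡ - seq (coeff f k) p
coeff-neg []      k       p = refl
coeff-neg (b ∷ f) zero    p = refl
coeff-neg (b ∷ f) (suc k) p = coeff-neg f k p

coeff-⊖ : ∀ f g k p → seq (coeff (f ⊖ g) k) p ≡ seq (coeff f k) p - seq (coeff g k) p
coeff-⊖ f g k p = trans (coeff-⊕ f (List.map D.-_ g) k p) (cong (seq (coeff f k) p +_) (coeff-neg g k p))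

coeff-∑ᶠ : ∀ {n} (F : Fin n → ℝ[T]) (f : ℕ → ℚ) k p →
  (∀ i → seq (coeff (F i) k) p ≡ f (toℕ i)) → seq (coeff (∑ᶠ F) k) p ≡ ∑ℚ f n
coeff-∑ᶠ {zero}  F f k p F≡f = refl
coeff-∑ᶠ {suc n} F f k p F≡f = begin
  seq (coeff (F Fin.zero ⊕ ∑ᶠ (F ∘ Fin.suc)) k) p                 ≡⟨ coeff-⊕ (F Fin.zero) (∑ᶠ (F ∘ Fin.suc)) k p ⟩
  seq (coeff (F Fin.zero) k) p + seq (coeff (∑ᶠ (F ∘ Fin.suc)) k) p ≡⟨ cong₂ _+_ (F≡f Fin.zero) (coeff-∑ᶠ (F ∘ Fin.suc) (f ∘ suc) k p (F≡f ∘ Fin.suc)) ⟩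
  f 0 + ∑ℚ (f ∘ suc) n                                            ≡⟨ ∑-head f n ⟨
  ∑ℚ f (suc n)                                                    ∎

starCoeff : (k b a p : ℕ) → ℚ
starCoeff zero    b a p = Z⋆ b a p
starCoeff (suc k) b a p = 0ℚ

coeff-const-ζ⋆ : ∀ k b a b>0 a>1 p → seq (coeff (const (ζ⋆ b a b>0 a>1)) k) p ≡ starCoeff k b a p
coeff-const-ζ⋆ zero    b a b>0 a>1 p = refl
coeff-const-ζ⋆ (suc k) b a b>0 a>1 p = refl

coeff-scaled : ∀ a x f k p q z → a ℚ./ 1 ≡ q → seq x p ≡ z →
  seq (coeff (fromℤ a · x · f) k) p ≡ q * (z * seq (coeff f k) p)
coeff-scaled a x f k p q z a≡q x≡z = trans (coeff-· (fromℤ a) (x · f) k p)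
  (cong₂ _*_ a≡q (trans (coeff-· x f k p) (cong (_* seq (coeff f k) p) x≡z)))

coeff-scaled-⊖ : ∀ a x f y k p q z t → a ℚ./ 1 ≡ q → seq x p ≡ z → seq (coeff (const y) k) p ≡ t →
  seq (coeff (fromℤ a · (x · f ⊖ const y)) k) p ≡ q * (z * seq (coeff f k) p - t)
coeff-scaled-⊖ a x f y k p q z t a≡q x≡z y≡t = trans (coeff-· (fromℤ a) (x · f ⊖ const y) k p)
  (cong₂ _*_ a≡q (trans (coeff-⊖ (x · f) (const y) k p)
    (cong₂ _-_ (trans (coeff-· x f k p) (cong (_* seq (coeff f k) p) x≡z)) y≡t)))

signedBinomial : ∀ i c → (-1ℤ ℤ.^ i ℤ.* (ℤ.+ c)) ℚ./ 1 ≡ (- 1ℚ) ^ i * ι c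
signedBinomial i c = trans (/1-* (-1ℤ ℤ.^ i) (ℤ.+ c)) (cong (_* ι c) (-1^ i))

unsignedBinomial : ∀ i c → ι c ≡ 1ℚ ^ i * ι c
unsignedBinomial i c = sym (trans (cong (_* ι c) (1^ i)) (ℚₚ.*-identityˡ (ι c)))

coeff-P : ∀ (ζˢʰ : ℕ → ℝ[T]) m n (m>1 : 1 ℕ.< m) (n>1 : 1 ℕ.< n) k p →
  let W = λ b p → seq (coeff (ζˢʰ b) k) p in
  seq (coeff (P ζˢʰ m n m>1 n>1) k) p ≡
  zetaPart m n W p - (- 1ℚ) ^ m * polarSum 1ℚ n m (λ a b → starCoeff k b a p)
coeff-P ζˢʰ m n m>1 n>1 k p = begin
  seq (coeff (∑ᶠ F ⊕ fromℤ (-1ℤ ℤ.^ m) · ∑ᶠ G) k) p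
    ≡⟨ coeff-⊕ (∑ᶠ F) (fromℤ (-1ℤ ℤ.^ m) · ∑ᶠ G) k p ⟩
  seq (coeff (∑ᶠ F) k) p + seq (coeff (fromℤ (-1ℤ ℤ.^ m) · ∑ᶠ G) k) p
    ≡⟨ cong₂ _+_ (coeff-∑ᶠ F _ k p F≡) (trans (coeff-· (fromℤ (-1ℤ ℤ.^ m)) (∑ᶠ G) k p) (cong₂ _*_ (-1^ m) (coeff-∑ᶠ G _ k p G≡))) ⟩
  polarSum (- 1ℚ) m n (λ a b → Z a p * W b) + σ * polarSum 1ℚ n m (λ a b → Z a p * W b - starCoeff k b a p)
    ≡⟨ cong (λ x → polarSum (- 1ℚ) m n (λ a b → Z a p * W b) + σ * x)
         (trans (polarSum-+ 1ℚ n m (λ a b → Z a p * W b) (λ a b → - starCoeff k b a p))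
           (cong (polarSum 1ℚ n m (λ a b → Z a p * W b) +_) (polarSum-neg 1ℚ n m (λ a b → starCoeff k b a p)))) ⟩
  polarSum (- 1ℚ) m n (λ a b → Z a p * W b) + σ * (polarSum 1ℚ n m (λ a b → Z a p * W b) - polarSum 1ℚ n m (λ a b → starCoeff k b a p))
    ≡⟨ solve 4 (λ x s y t → x :+ s :* (y :- t) := x :+ s :* y :- s :* t) refl
         (polarSum (- 1ℚ) m n (λ a b → Z a p * W b)) σ (polarSum 1ℚ n m (λ a b → Z a p * W b)) (polarSum 1ℚ n m (λ a b → starCoeff k b a p)) ⟩
  polarSum (- 1ℚ) m n (λ a b → Z a p * W b) + σ * polarSum 1ℚ n m (λ a b → Z a p * W b) - σ * polarSum 1ℚ n m (λ a b → starCoeff k b a p) ∎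
  where
  σ = (- 1ℚ) ^ m
  W : ℕ → ℚ
  W b = seq (coeff (ζˢʰ b) k) p
  F : Fin m → ℝ[T]
  F i = fromℤ (-1ℤ ℤ.^ toℕ i ℤ.* (ℤ.+ ((n ℕ.+ toℕ i ∸ 1) C toℕ i))) · ζ (n ℕ.+ toℕ i) (ℕₚ.m≤n⇒m≤n+o (toℕ i) n>1) · ζˢʰ (m ∸ toℕ i)
  G : Fin n → ℝ[T]
  G j = fromℤ (ℤ.+ ((m ℕ.+ toℕ j ∸ 1) C toℕ j)) ·
    (ζ (m ℕ.+ toℕ j) (ℕₚ.m≤n⇒m≤n+o (toℕ j) m>1) · ζˢʰ (n ∸ toℕ j)
      ⊖ const (ζ⋆ (n ∸ toℕ j) (m ℕ.+ toℕ j) (ℕₚ.m<n⇒0<n∸m (toℕ<n j)) (ℕₚ.m≤n⇒m≤n+o (toℕ j) m>1)))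
  F≡ : ∀ i → seq (coeff (F i) k) p ≡
    (- 1ℚ) ^ toℕ i * ι ((n ℕ.+ toℕ i ∸ 1) C toℕ i) * (Z (n ℕ.+ toℕ i) p * W (m ∸ toℕ i))
  F≡ i = coeff-scaled (-1ℤ ℤ.^ toℕ i ℤ.* (ℤ.+ ((n ℕ.+ toℕ i ∸ 1) C toℕ i))) (ζ (n ℕ.+ toℕ i) (ℕₚ.m≤n⇒m≤n+o (toℕ i) n>1)) (ζˢʰ (m ∸ toℕ i)) k p
    ((- 1ℚ) ^ toℕ i * ι ((n ℕ.+ toℕ i ∸ 1) C toℕ i)) (Z (n ℕ.+ toℕ i) p) (signedBinomial (toℕ i) ((n ℕ.+ toℕ i ∸ 1) C toℕ i)) refl
  G≡ : ∀ j → seq (coeff (G j) k) p ≡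
    1ℚ ^ toℕ j * ι ((m ℕ.+ toℕ j ∸ 1) C toℕ j) * (Z (m ℕ.+ toℕ j) p * W (n ∸ toℕ j) - starCoeff k (n ∸ toℕ j) (m ℕ.+ toℕ j) p)
  G≡ j = coeff-scaled-⊖ (ℤ.+ ((m ℕ.+ toℕ j ∸ 1) C toℕ j)) (ζ (m ℕ.+ toℕ j) (ℕₚ.m≤n⇒m≤n+o (toℕ j) m>1)) (ζˢʰ (n ∸ toℕ j))
    (ζ⋆ (n ∸ toℕ j) (m ℕ.+ toℕ j) (ℕₚ.m<n⇒0<n∸m (toℕ<n j)) (ℕₚ.m≤n⇒m≤n+o (toℕ j) m>1)) k p
    (1ℚ ^ toℕ j * ι ((m ℕ.+ toℕ j ∸ 1) C toℕ j)) (Z (m ℕ.+ toℕ j) p) (starCoeff k (n ∸ toℕ j) (m ℕ.+ toℕ j) p)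
    (unsignedBinomial (toℕ j) ((m ℕ.+ toℕ j ∸ 1) C toℕ j)) refl
    (coeff-const-ζ⋆ k (n ∸ toℕ j) (m ℕ.+ toℕ j) (ℕₚ.m<n⇒0<n∸m (toℕ<n j)) (ℕₚ.m≤n⇒m≤n+o (toℕ j) m>1) p)

zetaPart-- : ∀ m n (D E : ℕ → ℕ → ℚ) p → zetaPart m n (λ b p → D b p - E b p) p ≡ zetaPart m n D p - zetaPart m n E p
zetaPart-- m n D E p = trans (cong₂ (λ x y → x + σ * y) (split (- 1ℚ) m n) (split 1ℚ n m))
  (solve 5 (λ s a b c d → (a :- b) :+ s :* (c :- d) := a :+ s :* c :- (b :+ s :* d)) refl σ
    (S (- 1ℚ) m n D) (S (- 1ℚ) m n E) (S 1ℚ n m D) (S 1ℚ n m E))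
  where
  σ = (- 1ℚ) ^ m
  S : ℚ → ℕ → ℕ → (ℕ → ℕ → ℚ) → ℚ
  S s m n D = polarSum s m n (λ a b → Z a p * D b p)
  split : ∀ s m n → S s m n (λ b p → D b p - E b p) ≡ S s m n D - S s m n E
  split s m n = begin
    S s m n (λ b p → D b p - E b p)
      ≡⟨ polarSum-cong s m n (λ a b → solve 3 (λ z d e → z :* (d :- e) := z :* d :+ :- (z :* e)) refl (Z a p) (D b p) (E b p)) ⟩
    polarSum s m n (λ a b → Z a p * D b p + - (Z a p * E b p))
      ≡⟨ polarSum-+ s m n (λ a b → Z a p * D b p) (λ a b → - (Z a p * E b p)) ⟩
    S s m n D + polarSum s m n (λ a b → - (Z a p * E b p))
      ≡⟨ cong (S s m n D +_) (polarSum-neg s m n (λ a b → Z a p * E b p)) ⟩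
    S s m n D - S s m n E ∎

-- `truncatedIdentity` rearranged so that the left side consists of errors only: the deviations of
-- `W b` from `Z b`, and the overflows. The right side is the constant coefficient of ζ(m,n) -
-- P(m,n) at index p.
Z₂-P₀ : ∀ m n W p → 0 ℕ.< m ℕ.+ n →
  zetaPart m n (λ b p → Z b p - W b p) p + ((- 1ℚ) ^ m * polarSum 1ℚ n m (overflow p) + - overflow p m n)
  ≡ Z₂ m n p - (zetaPart m n W p - (- 1ℚ) ^ m * polarSum 1ℚ n m (λ a b → Z⋆ b a p))
Z₂-P₀ m n W p 0<m+n = begin
  zetaPart m n (λ b p → Z b p - W b p) p + (σ * o + - overflow p m n)
    ≡⟨ cong (_+ (σ * o + - overflow p m n)) (zetaPart-- m n Z W p) ⟩
  x + σ * y - w + (σ * o + - overflow p m n)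
    ≡⟨ solve 7 (λ x s y w o v t → x :+ s :* y :- w :+ (s :* o :+ :- v) := x :+ s :* (o :+ (y :- t)) :- v :- (w :- s :* t)) refl
         x σ y w o (overflow p m n) t ⟩
  x + σ * (o + (y - t)) - overflow p m n - (w - σ * t)
    ≡⟨ cong (λ r → x + σ * r - overflow p m n - (w - σ * t)) expand ⟨
  x + σ * polarSum 1ℚ n m (λ a b → overflow p a b + (Z a p * Z b p - Z⋆ b a p)) - overflow p m n - (w - σ * t)
    ≡⟨ cong (λ r → r - overflow p m n - (w - σ * t)) (truncatedIdentity m n p 0<m+n) ⟨
  Z₂ m n p + overflow p m n - overflow p m n - (w - σ * t)
    ≡⟨ solve 3 (λ z v r → z :+ v :- v :- r := z :- r) refl (Z₂ m n p) (overflow p m n) (w - σ * t) ⟩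
  Z₂ m n p - (w - σ * t) ∎
  where
  σ = (- 1ℚ) ^ m
  o = polarSum 1ℚ n m (overflow p)
  x = polarSum (- 1ℚ) m n (λ a b → Z a p * Z b p)
  y = polarSum 1ℚ n m (λ a b → Z a p * Z b p)
  w = zetaPart m n W p
  t = polarSum 1ℚ n m (λ a b → Z⋆ b a p)
  expand : polarSum 1ℚ n m (λ a b → overflow p a b + (Z a p * Z b p - Z⋆ b a p)) ≡ o + (y - t)
  expand = trans (polarSum-+ 1ℚ n m (overflow p) (λ a b → Z a p * Z b p - Z⋆ b a p))
    (cong (o +_) (trans (polarSum-+ 1ℚ n m (λ a b → Z a p * Z b p) (λ a b → - Z⋆ b a p))
      (cong (y +_) (polarSum-neg 1ℚ n m (λ a b → Z⋆ b a p)))))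

regularised-coeff₀ : ∀ b z → 1 ℕ.< b → IsShuffleRegularised b z → IsNull (λ p → Z b p - seq (coeff z 0) p)
regularised-coeff₀ b z b>1 (c₀ , c₁ , asym , z≋) = null-cong
  (λ p → solve 3 (λ x c w → (x :- c) :+ :- (w :- c) := x :- w) refl (Z b p) (seq c₀ p) (seq (coeff z 0) p))
  (null-+ (asymptotics⇒c₀≈ζ b b>1 c₀ c₁ asym) (null-neg (z≋ 0)))

regularised-coeff₊ : ∀ b z → 1 ℕ.< b → IsShuffleRegularised b z → ∀ k → IsNull (seq (coeff z (suc k)))
regularised-coeff₊ b z b>1 (c₀ , c₁ , asym , z≋) zero = null-cong
  (λ p → solve 2 (λ w c → (w :- c) :+ c := w) refl (seq (coeff z 1) p) (seq c₁ p))
  (null-+ (z≋ 1) (asymptotics⇒c₁-null b b>1 c₀ c₁ asym))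
regularised-coeff₊ b z b>1 (c₀ , c₁ , asym , z≋) (suc k) =
  null-cong (λ p → ℚₚ.+-identityʳ (seq (coeff z (suc (suc k))) p)) (z≋ (suc (suc k)))

theorem2p3 : (ζˢʰ : ℕ → ℝ[T]) → (∀ k → 0 <ᴺ k → IsShuffleRegularised k (ζˢʰ k)) →
    ∀ (m n : ℕ) (m>1 : 1 <ᴺ m) (n>1 : 1 <ᴺ n) →
    const (ζ₂ m n (<⇒≤ m>1) n>1) ≋ P ζˢʰ m n m>1 n>1
theorem2p3 ζˢʰ reg m n m>1 n>1 zero = null-cong
  (λ p → trans (Z₂-P₀ m n W p (ℕₚ.m≤n⇒m≤n+o n (ℕₚ.<⇒≤ m>1))) (cong (λ x → Z₂ m n p - x) (sym (coeff-P ζˢʰ m n m>1 n>1 0 p))))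
  (null-+ (zetaPart-null m n m>1 n>1 (λ b p → Z b p - W b p) (λ b b>1 → regularised-coeff₀ b (ζˢʰ b) b>1 (reg b (ℕₚ.<⇒≤ b>1))))
    (null-+ (null-* (bounded-const ((- 1ℚ) ^ m)) (polarSum-null 1ℚ n m overflow
        (λ j j<n → overflow-null (m ℕ.+ j) (n ∸ j) (ℕₚ.m≤n⇒m≤n+o j m>1) (ℕₚ.m<n⇒0<n∸m j<n))))
      (null-neg (overflow-null m n m>1 (ℕₚ.<⇒≤ n>1)))))
  where
  W : ℕ → ℕ → ℚ
  W b p = seq (coeff (ζˢʰ b) 0) p
-- In positive degree the left side and the star terms are 0. The coefficients of `ζˢʰ b` are null
-- for b > 1, and those of `ζˢʰ 1`, which carry the T-terms, cancel in `zetaPart-null`.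
theorem2p3 ζˢʰ reg m n m>1 n>1 (suc k) = null-cong
  (λ p → trans (solve 2 (λ w t → :- w :+ t := con 0ℚ :- (w :- t)) refl (zetaPart m n W p) ((- 1ℚ) ^ m * polarSum 1ℚ n m (λ _ _ → 0ℚ)))
    (cong (λ x → 0ℚ - x) (sym (coeff-P ζˢʰ m n m>1 n>1 (suc k) p))))
  (null-+ (null-neg (zetaPart-null m n m>1 n>1 W (λ b b>1 → regularised-coeff₊ b (ζˢʰ b) b>1 (reg b (ℕₚ.<⇒≤ b>1)) k)))
    (null-* (bounded-const ((- 1ℚ) ^ m)) (polarSum-null 1ℚ n m (λ _ _ _ → 0ℚ) (λ _ _ → null-0))))
  where
  W : ℕ → ℕ → ℚ
  W b p = seq (coeff (ζˢʰ b) (suc k)) p
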